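{- A Superposed Term Rewrite System (STRS) $\mathfrak R$ is terminating if there exists a well-founded weakly monotonic quasi-ordering $\succeq$ on classical terms, where $\succ$ and $\succeq$ are closed under substitution, such that: - $l\succeq r_i$ for all rules $l\to\sum_{i=1}^n\alpha_i\cdot r_i\in\mathcal R$ (right-hand side written in canonical form, $\sum_{i=1}^n\alpha_i\cdot r_i\in\mathrm{CAN}$) and for all $i$; - $s\succ t$ for all dependency pairs $\langle s,t\rangle$ of $\mathfrak R$.
   Context: **Syntax.** $\mathcal X$ is a countable set of variables; $\mathcal A,\mathcal C,\mathcal F$ are pairwise disjoint signatures (symbols $b$ with arity $\mathrm{ar}(b)\in\mathbb N$) of amplitude, constructor and function symbols. Constructors include a unit $()$, $|0\rangle$, $|1\rangle$, $\mathtt 0$ (arity 0), $\mathtt S$ (arity 1), pairing $(\cdot,\cdot)$ (arity 2), $[\,]$ (arity 0) and list-cons $h::t$ (arity 2). Grammar: naturals $\iota::=x\mid\mathtt 0\mid\mathtt S(\iota)$; amplitudes $\alpha::=\mathtt a(\iota,\dots,\iota)\mid\alpha\cdot\alpha\mid\alpha+\alpha$; terms $t::=x\mid c(t,\dots,t)\mid f(t,\dots,t)\mid\alpha\cdot t\mid t+t$; values $v::=c(v,\dots,v)\mid\alpha\cdot v\ (\alpha\text{ ground})\mid v+v$. A term or amplitude is ground if it has no variable; $\mathscr T_0$ is the set of ground terms. A term is classical if it contains neither $+$ nor $\alpha\cdot$. A substitution $\sigma$ maps variables to values. **Amplitudes.** Each $\mathtt a\in\mathcal A$ has a total interpretation $[\![\mathtt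 a]\!]:\mathbb N^{\mathrm{ar}(\mathtt a)}\to\mathbb C$, extended to ground amplitudes in the obvious way (sums to sums, products to products, $\mathtt S^n(\mathtt 0)$ to $n$). For a non-ground $\alpha$, $[\![\alpha]\!]=\lambda$ means $[\![\alpha\sigma]\!]=\lambda$ for every $\sigma$ such that $\alpha\sigma$ is a ground amplitude. **Equivalence.** $\equiv$ is the smallest equivalence relation on terms, closed under all term contexts ($s\equiv t\Rightarrow C[s]\equiv C[t]$), with: $t_1+t_2\equiv t_2+t_1$; $t_1+(t_2+t_3)\equiv(t_1+t_2)+t_3$; $s+\alpha\cdot t\equiv s$ if $[\![\alpha]\!]=0$; $\alpha\cdot t\equiv t$ if $[\![\alpha]\!]=1$; $\alpha\cdot(\beta\cdot t)\equiv(\alpha\cdot\beta)\cdot t$; $\alpha\cdot(t_1+t_2)\equiv\alpha\cdot t_1+\alpha\cdot t_2$; $\alpha\cdot t+\beta\cdot t\equiv(\alpha+\beta)\cdot t$; and, for $b\in\mathcal C\uplus\mathcal F$, $b(\dots,\alpha\cdot t,\dots)\equiv\alpha\cdot b(\dots,t,\dots)$ and $b(\dots,t_1+t_2,\dots)\equiv b(\dots,t_1,\dots)+b(\dots,t_2,\dots)$. A canonical form of $t$ is a term $\sum_{i=1}^n\alpha_i\cdot t_i\equiv t$ with the $t_i$ pairwise distinct classical terms and $[\![\alpha_i]\!]\neq0$; $\mathrm{CAN}$ is the set of canonical forms. **STRS.** A rewrite rule is $l\to r$ with $l=f(p_1,\dots,p_n)$, $f\in\mathcal F$, each $p_i$ a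 classical term without function symbols, and $\mathrm{Var}(r)\subseteq\mathrm{Var}(l)$. An STRS $\mathfrak R$ consists of $\mathcal A,\mathcal C,\mathcal F,\mathcal X$, a set $\mathcal R$ of orthogonal rules (left-linear and with pairwise non-overlapping left-hand sides), and a main symbol $f\in\mathcal F$. **Reduction.** Evaluation contexts: $E::=\diamond\mid b(v_1,\dots,v_{i-1},E,t_{i+1},\dots,t_n)$ with $b\in\mathcal C\uplus\mathcal F$ and $v_j$ values. $\to_{\mathfrak R}\subseteq\mathscr T_0\times\mathscr T_0$ is defined inductively by: (C) if $l\to r\in\mathcal R$ and $E[l\sigma]$ is classical then $E[l\sigma]\to_{\mathfrak R}E[r\sigma]$; (E) if $s\equiv s'\to_{\mathfrak R}t'\equiv t$ then $s\to_{\mathfrak R}t$; (Q) if $\sum_i\alpha_i\cdot s_i\in\mathrm{CAN}$, $s_i\to^?_{\mathfrak R}t_i$ for all $i$, and $s_i\to_{\mathfrak R}t_i$ for some $i$, then $\sum_i\alpha_i\cdot s_i\to_{\mathfrak R}\sum_i\alpha_i\cdot t_i$. Here $s\to^?_{\mathfrak R}t$ iff ($s\in\mathrm{NF}_{\mathfrak R}$ and $t=s$) or $s\to_{\mathfrak R}t$, and $\mathrm{NF}_{\mathfrak R}$ is the set of ground terms with no $\to_{\mathfrak R}$-reduct. A term terminates if, for some $k\in\mathbb N$, all reduction chains from it reach a normal form in at most $k$ steps; an STRS is terminating if every ground term terminates. **Dependency pairs and orders.** For a classical term $p$ and a term $r$, $p\triangleleft_{\mathrm{CAN}}r$ means $r\equiv\sum_{i=1}^n\alpha_i\cdot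 r_i\in\mathrm{CAN}$ with $r_i=p$ for some $i$. Each $f\in\mathcal F$ is given a new tuple symbol $F$ of the same signature. If $f(s_1,\dots,s_n)\to r\in\mathcal R$ and $C[g(t_1,\dots,t_m)]\triangleleft_{\mathrm{CAN}}r$ for some context $C$ and $g\in\mathcal F$, then $\langle F(s_1,\dots,s_n),G(t_1,\dots,t_m)\rangle$ is a dependency pair of $\mathfrak R$. The quasi-order is on classical terms over the signature extended with tuple symbols. A quasi-order $\succeq$ is a reflexive transitive relation with strict part $s\succ t\iff s\succeq t\wedge\neg(t\succeq s)$; it is well-founded if there is no infinite chain $t_1\succ t_2\succ\cdots$; weakly monotonic if $s\succeq t$ implies $b(\dots,s,\dots)\succeq b(\dots,t,\dots)$ for every symbol $b$; a relation is closed under substitution if it is preserved by applying any substitution (mapping variables to classical values) to both sides.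
   Formalization: Assumes in addition that some amplitude denotes 1; otherwise right-hand sides may have no canonical form and the claim fails, e.g. with [[a]]=2 and the single rule f → f+f the conditions hold vacuously but a·f does not terminate. -}

module Defs where

open import Data.Empty using (⊥-elim)
open import Data.Fin as Fin using (Fin; zero; suc)
open import Data.Nat as ℕ using (ℕ; zero; suc)
import Data.Nat.Properties as ℕ
open import Data.Product using (Σ-syntax; ∃-syntax; _×_; _,_)
open import Data.Rational as ℚ using (ℚ; 0ℚ; 1ℚ)
import Data.Rational.Properties as ℚ
open import Data.Rational.Solver using (module +-*-Solver)
open import Data.Sum using (_⊎_; inj₁; inj₂; [_,_]′)
open import Data.Vec using (Vec; []; _∷_; lookup; _[_]≔_)
open import Data.Vec.Relation.Binary.Pointwise.Inductive using (Pointwise)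
open import Data.Vec.Relation.Unary.All using (All)
open import Data.Vec.Relation.Unary.Any using (Any; here; there)
open import Function.Base using (_∘_)
open import Function.Bundles using (_↣_)
open import Function.Definitions using (Injective)
open import Level using (0ℓ)
open import Relation.Binary.Core using (Rel)
open import Relation.Binary.PropositionalEquality using (_≡_; refl; sym; trans; cong; subst; subst₂)
open import Relation.Nullary using (¬_)

-- ℝ consists of the Cauchy sequences of rationals, with a setoid equality.

Cauchy : (ℕ → ℚ) → Set
Cauchy x = ∀ ε → 0ℚ ℚ.< ε →
  ∃[ N ] (∀ m n → N ℕ.≤ m → N ℕ.≤ n → ℚ.∣ x m ℚ.- x n ∣ ℚ.< ε)

record ℝ : Set where
  constructor mkℝ
  field
    seq    : ℕ → ℚ
    cauchy : Cauchy seq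
open ℝ public

infix 4 _≈ᴿ_
_≈ᴿ_ : Rel ℝ 0ℓ
x ≈ᴿ y = ∀ ε → 0ℚ ℚ.< ε →
  ∃[ N ] (∀ n → N ℕ.≤ n → ℚ.∣ seq x n ℚ.- seq y n ∣ ℚ.< ε)

private
  open +-*-Solver using (solve; _:=_; _:+_; _:*_; _:-_; :-_)

  minus-plus : ∀ a b → (a ℚ.- b) ℚ.+ b ≡ a
  minus-plus = solve 2 (λ a b → (a :- b) :+ b := a) refl

  neg-minus : ∀ a b → ℚ.- (a ℚ.- b) ≡ (ℚ.- a) ℚ.- (ℚ.- b)
  neg-minus = solve 2 (λ a b → :- (a :- b) := (:- a) :- (:- b)) refl

  +-interchange : ∀ a b c d → (a ℚ.- b) ℚ.+ (c ℚ.- d) ≡ (a ℚ.+ c) ℚ.- (b ℚ.+ d)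
  +-interchange = solve 4 (λ a b c d → (a :- b) :+ (c :- d) := (a :+ c) :- (b :+ d)) refl

  *-difference : ∀ a b c d → a ℚ.* (b ℚ.- d) ℚ.+ d ℚ.* (a ℚ.- c) ≡ (a ℚ.* b) ℚ.- (c ℚ.* d)
  *-difference = solve 4 (λ a b c d → a :* (b :- d) :+ d :* (a :- c) := (a :* b) :- (c :* d)) refl

  ½+½≡1 : ℚ.½ ℚ.+ ℚ.½ ≡ 1ℚ
  ½+½≡1 = refl

  half : ∀ ε → 0ℚ ℚ.< ε → ∃[ δ ] (0ℚ ℚ.< δ × δ ℚ.+ δ ≡ ε)
  half ε 0<ε = ε ℚ.* ℚ.½ , ℚ.positive⁻¹ (ε ℚ.* ℚ.½) {{ℚ.pos*pos⇒pos ε {{ℚ.positive 0<ε}} ℚ.½}} ,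
    eq
    where
    eq : ε ℚ.* ℚ.½ ℚ.+ ε ℚ.* ℚ.½ ≡ ε
    eq = trans (sym (ℚ.*-distribˡ-+ ε ℚ.½ ℚ.½)) (trans (cong (ε ℚ.*_) ½+½≡1) (ℚ.*-identityʳ ε))

  cauchy-const : ∀ q → Cauchy (λ _ → q)
  cauchy-const q ε 0<ε = 0 , λ _ _ _ _ →
    subst (λ z → ℚ.∣ z ∣ ℚ.< ε) (sym (ℚ.+-inverseʳ q)) 0<ε

  cauchy-+ : ∀ {x y} → Cauchy x → Cauchy y → Cauchy (λ n → x n ℚ.+ y n)
  cauchy-+ {x} {y} cx cy ε 0<ε with half ε 0<ε
  ... | δ , 0<δ , δ+δ≡ε with cx δ 0<δ | cy δ 0<δ
  ... | M , hx | N , hy = M ℕ.⊔ N , λ m n K≤m K≤n →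
    let dx = x m ℚ.- x n
        dy = y m ℚ.- y n
        px = hx m n (ℕ.m⊔n≤o⇒m≤o M N K≤m) (ℕ.m⊔n≤o⇒m≤o M N K≤n)
        py = hy m n (ℕ.m⊔n≤o⇒n≤o M N K≤m) (ℕ.m⊔n≤o⇒n≤o M N K≤n)
    in subst₂ (λ a b → ℚ.∣ a ∣ ℚ.< b)
         (+-interchange (x m) (x n) (y m) (y n))
         δ+δ≡ε
         (ℚ.≤-<-trans (ℚ.∣p+q∣≤∣p∣+∣q∣ dx dy) (ℚ.+-mono-< px py))

  cauchy-neg : ∀ {x} → Cauchy x → Cauchy (λ n → ℚ.- x n)
  cauchy-neg {x} cx ε 0<ε with cx ε 0<ε
  ... | N , h = N , λ m n p q →
    subst (λ z → z ℚ.< ε)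
      (sym (subst (λ z → ℚ.∣ z ∣ ≡ ℚ.∣ x m ℚ.- x n ∣)
        (neg-minus (x m) (x n))
        (ℚ.∣-p∣≡∣p∣ (x m ℚ.- x n))))
      (h m n p q)

  eventually-bounded : ∀ {x} → Cauchy x →
    ∃[ B ] (0ℚ ℚ.< B × ∃[ N ] (∀ n → N ℕ.≤ n → ℚ.∣ x n ∣ ℚ.≤ B))
  eventually-bounded {x} cx with cx 1ℚ (ℚ.positive⁻¹ 1ℚ)
  ... | N , h = 1ℚ ℚ.+ ℚ.∣ x N ∣ ,
    ℚ.positive⁻¹ _ {{ℚ.pos+nonNeg⇒pos 1ℚ ℚ.∣ x N ∣ {{ℚ.∣-∣-nonNeg (x N)}}}} ,
    N , λ n N≤n → subst (λ z → ℚ.∣ z ∣ ℚ.≤ 1ℚ ℚ.+ ℚ.∣ x N ∣)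
      (minus-plus (x n) (x N))
      (ℚ.≤-trans (ℚ.∣p+q∣≤∣p∣+∣q∣ (x n ℚ.- x N) (x N))
        (ℚ.+-monoˡ-≤ ℚ.∣ x N ∣ (ℚ.<⇒≤ (h n N N≤n ℕ.≤-refl))))

  quotient : ∀ ε K → 0ℚ ℚ.< ε → 0ℚ ℚ.< K → ∃[ δ ] (0ℚ ℚ.< δ × K ℚ.* δ ≡ ε)
  quotient ε K 0<ε 0<K = 1/K ℚ.* ε , ℚ.positive⁻¹ _ {{ℚ.pos*pos⇒pos 1/K {{ℚ.1/pos⇒pos K}} ε}} , eq
    where
    instance
      posε = ℚ.positive 0<ε
      posK = ℚ.positive 0<K
      nzK  = ℚ.pos⇒nonZero K
    1/K = ℚ.1/ K
    eq : K ℚ.* (1/K ℚ.* ε) ≡ ε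
    eq = trans (sym (ℚ.*-assoc K 1/K ε))
           (trans (cong (ℚ._* ε) (ℚ.*-inverseʳ K)) (ℚ.*-identityˡ ε))

  +-positive : ∀ {p q} → 0ℚ ℚ.< p → 0ℚ ℚ.< q → 0ℚ ℚ.< p ℚ.+ q
  +-positive {p} {q} 0<p 0<q =
    ℚ.<-trans 0<p (subst (ℚ._< p ℚ.+ q) (ℚ.+-identityʳ p) (ℚ.+-monoʳ-< p 0<q))

  product-< : ∀ {p q B δ} → 0ℚ ℚ.< B → ℚ.∣ p ∣ ℚ.≤ B → ℚ.∣ q ∣ ℚ.< δ → ℚ.∣ p ℚ.* q ∣ ℚ.< B ℚ.* δ
  product-< {p} {q} {B} {δ} 0<B p≤B q<δ = subst (ℚ._< B ℚ.* δ) (sym (ℚ.∣p*q∣≡∣p∣*∣q∣ p q))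
    (ℚ.≤-<-trans
      (ℚ.*-monoʳ-≤-nonNeg ℚ.∣ q ∣ {{ℚ.∣-∣-nonNeg q}} p≤B)
      (ℚ.*-monoʳ-<-pos B {{ℚ.positive 0<B}} q<δ))

  *-close : ∀ a b c d {A B δ ε} → 0ℚ ℚ.< A → 0ℚ ℚ.< B → (A ℚ.+ B) ℚ.* δ ≡ ε →
    ℚ.∣ a ∣ ℚ.≤ A → ℚ.∣ d ∣ ℚ.≤ B → ℚ.∣ a ℚ.- c ∣ ℚ.< δ → ℚ.∣ b ℚ.- d ∣ ℚ.< δ →
    ℚ.∣ a ℚ.* b ℚ.- c ℚ.* d ∣ ℚ.< ε
  *-close a b c d {A} {B} {δ} {ε} 0<A 0<B eq a≤A d≤B a-c<δ b-d<δ =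
    subst (λ z → ℚ.∣ z ∣ ℚ.< ε) (*-difference a b c d)
      (subst (ℚ.∣ p ℚ.+ q ∣ ℚ.<_) (trans (sym (ℚ.*-distribʳ-+ δ A B)) eq)
        (ℚ.≤-<-trans (ℚ.∣p+q∣≤∣p∣+∣q∣ p q)
          (ℚ.+-mono-< {ℚ.∣ p ∣} {A ℚ.* δ} {ℚ.∣ q ∣} {B ℚ.* δ}
            (product-< {a} {b ℚ.- d} 0<A a≤A b-d<δ)
            (product-< {d} {a ℚ.- c} 0<B d≤B a-c<δ))))
    where
    p = a ℚ.* (b ℚ.- d)
    q = d ℚ.* (a ℚ.- c)

  cauchy-* : ∀ {x y} → Cauchy x → Cauchy y → Cauchy (λ n → x n ℚ.* y n)
  cauchy-* {x} {y} cx cy ε 0<ε =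
    let A , 0<A , M , hA = eventually-bounded cx
        B , 0<B , N , hB = eventually-bounded cy
        δ , 0<δ , eq     = quotient ε (A ℚ.+ B) 0<ε (+-positive 0<A 0<B)
        M′ , hx          = cx δ 0<δ
        N′ , hy          = cy δ 0<δ
        l = M ℕ.⊔ N
        r = M′ ℕ.⊔ N′
    in l ℕ.⊔ r , λ m n K≤m K≤n →
      let m₁ = ℕ.m⊔n≤o⇒m≤o l r K≤m
          m₂ = ℕ.m⊔n≤o⇒n≤o l r K≤m
          n₁ = ℕ.m⊔n≤o⇒m≤o l r K≤n
          n₂ = ℕ.m⊔n≤o⇒n≤o l r K≤n
      in *-close (x m) (y m) (x n) (y n) 0<A 0<B eq
           (hA m (ℕ.m⊔n≤o⇒m≤o M N m₁))
           (hB n (ℕ.m⊔n≤o⇒n≤o M N n₁))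
           (hx m n (ℕ.m⊔n≤o⇒m≤o M′ N′ m₂) (ℕ.m⊔n≤o⇒m≤o M′ N′ n₂))
           (hy m n (ℕ.m⊔n≤o⇒n≤o M′ N′ m₂) (ℕ.m⊔n≤o⇒n≤o M′ N′ n₂))

fromℚ : ℚ → ℝ
fromℚ q = mkℝ (λ _ → q) (cauchy-const q)

infixl 6 _+ᴿ_
infixl 7 _*ᴿ_
infix  8 -ᴿ_

_+ᴿ_ : ℝ → ℝ → ℝ
x +ᴿ y = mkℝ (λ n → seq x n ℚ.+ seq y n) (cauchy-+ {seq x} {seq y} (cauchy x) (cauchy y))

-ᴿ_ : ℝ → ℝ
-ᴿ x = mkℝ (λ n → ℚ.- seq x n) (cauchy-neg {seq x} (cauchy x))

_*ᴿ_ : ℝ → ℝ → ℝ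
x *ᴿ y = mkℝ (λ n → seq x n ℚ.* seq y n) (cauchy-* {seq x} {seq y} (cauchy x) (cauchy y))

record ℂ : Set where
  constructor _+i_
  field
    re im : ℝ
open ℂ public

infix 4 _≈_
_≈_ : Rel ℂ 0ℓ
w ≈ z = (re w ≈ᴿ re z) × (im w ≈ᴿ im z)

0ℂ 1ℂ : ℂ
0ℂ = fromℚ 0ℚ +i fromℚ 0ℚ
1ℂ = fromℚ 1ℚ +i fromℚ 0ℚ

_+ᶜ_ _*ᶜ_ : ℂ → ℂ → ℂ
w +ᶜ z = (re w +ᴿ re z) +i (im w +ᴿ im z)
w *ᶜ z = (re w *ᴿ re z +ᴿ -ᴿ (im w *ᴿ im z)) +i (re w *ᴿ im z +ᴿ im w *ᴿ re z)

record Signature : Set₁ where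
  field
    Sym : Set
    ar  : Sym → ℕ
open Signature public

-- The constructor signature 𝒞 consists of the prescribed constructors
-- and of an arbitrary signature of further ones.
data Constructor (K : Set) : Set where
  unit ket0 ket1 zero suc pair nil cons : Constructor K
  other                                 : K → Constructor K

constructors : Signature → Signature
constructors K .Sym = Constructor (Sym K)
constructors K .ar unit      = 0
constructors K .ar ket0      = 0
constructors K .ar ket1      = 0
constructors K .ar zero      = 0
constructors K .ar suc       = 1
constructors K .ar pair      = 2
constructors K .ar nil       = 0
constructors K .ar cons      = 2
constructors K .ar (other k) = ar K k

record Alphabet : Set₁ where
  field
    𝒜         : Signature
    ⟦_⟧ˢ      : (a : Sym 𝒜) → Vec ℕ (ar 𝒜 a) → ℂ
    𝒦         : Signature
    ℱ         : Signature
    𝒳         : Set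
    countable : 𝒳 ↣ ℕ

  𝒞 : Signature
  𝒞 = constructors 𝒦

-- f ↦ inj₁ f is the original function symbol, inj₂ f its tuple symbol F.
_♯ : Alphabet → Alphabet
S ♯ = record
  { 𝒜 = 𝒜 ; ⟦_⟧ˢ = ⟦_⟧ˢ ; 𝒦 = 𝒦 ; 𝒳 = 𝒳 ; countable = countable
  ; ℱ = record { Sym = Sym ℱ ⊎ Sym ℱ ; ar = [ ar ℱ , ar ℱ ]′ }
  }
  where open Alphabet S

module Amplitudes (𝒜 : Signature) (𝒳 : Set) where

  data Nat : Set where
    var  : 𝒳 → Nat
    zero : Nat
    suc  : Nat → Nat

  infixl 7 _⊙_
  infixl 6 _⊕_
  data Amp : Set where
    amp : (a : Sym 𝒜) → Vec Nat (ar 𝒜 a) → Amp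
    _⊙_ : Amp → Amp → Amp
    _⊕_ : Amp → Amp → Amp

  data _∈ᴺ_ (x : 𝒳) : Nat → Set where
    var : x ∈ᴺ var x
    suc : ∀ {ι} → x ∈ᴺ ι → x ∈ᴺ suc ι

  data _∈ᴬ_ (x : 𝒳) : Amp → Set where
    amp : ∀ {a ιs} → Any (x ∈ᴺ_) ιs → x ∈ᴬ amp a ιs
    ⊙ˡ  : ∀ {α β} → x ∈ᴬ α → x ∈ᴬ (α ⊙ β)
    ⊙ʳ  : ∀ {α β} → x ∈ᴬ β → x ∈ᴬ (α ⊙ β)
    ⊕ˡ  : ∀ {α β} → x ∈ᴬ α → x ∈ᴬ (α ⊕ β)
    ⊕ʳ  : ∀ {α β} → x ∈ᴬ β → x ∈ᴬ (α ⊕ β)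

  GroundAmp : Amp → Set
  GroundAmp α = ∀ x → ¬ (x ∈ᴬ α)

  ⟦_⟧ᴺ : (ι : Nat) → (∀ x → ¬ (x ∈ᴺ ι)) → ℕ
  ⟦ var x ⟧ᴺ g = ⊥-elim (g x var)
  ⟦ zero  ⟧ᴺ g = 0
  ⟦ suc ι ⟧ᴺ g = suc (⟦ ι ⟧ᴺ λ x p → g x (suc p))

  ⟦_⟧ᴺˢ : ∀ {n} (ιs : Vec Nat n) → (∀ x → ¬ Any (x ∈ᴺ_) ιs) → Vec ℕ n
  ⟦ []     ⟧ᴺˢ g = []
  ⟦ ι ∷ ιs ⟧ᴺˢ g = ⟦ ι ⟧ᴺ (λ x p → g x (here p)) ∷ ⟦ ιs ⟧ᴺˢ (λ x p → g x (there p))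

  module Interpretation (⟦_⟧ˢ : (a : Sym 𝒜) → Vec ℕ (ar 𝒜 a) → ℂ) where

    ⟦_⟧ᴬ : (α : Amp) → GroundAmp α → ℂ
    ⟦ amp a ιs ⟧ᴬ g = ⟦ a ⟧ˢ (⟦ ιs ⟧ᴺˢ λ x p → g x (amp p))
    ⟦ α ⊙ β    ⟧ᴬ g = ⟦ α ⟧ᴬ (λ x p → g x (⊙ˡ p)) *ᶜ ⟦ β ⟧ᴬ (λ x p → g x (⊙ʳ p))
    ⟦ α ⊕ β    ⟧ᴬ g = ⟦ α ⟧ᴬ (λ x p → g x (⊕ˡ p)) +ᶜ ⟦ β ⟧ᴬ (λ x p → g x (⊕ʳ p))

module Terms (S : Alphabet) where

  open Alphabet S
  open Amplitudes 𝒜 𝒳 public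
  open Interpretation ⟦_⟧ˢ public

  data Symbol : Set where
    con : Sym 𝒞 → Symbol
    fun : Sym ℱ → Symbol

  arity : Symbol → ℕ
  arity (con c) = ar 𝒞 c
  arity (fun f) = ar ℱ f

  infixr 7 _·_
  infixl 6 _+_
  data Term : Set where
    var : 𝒳 → Term
    app : (b : Symbol) → Vec Term (arity b) → Term
    _·_ : Amp → Term → Term
    _+_ : Term → Term → Term

  -- The elements of x ∈ᵗ t are in bijection with the occurrences of x in t.
  data _∈ᵗ_ (x : 𝒳) : Term → Set where
    var : x ∈ᵗ var x
    app : ∀ {b ts} → Any (x ∈ᵗ_) ts → x ∈ᵗ app b ts
    ·ˡ  : ∀ {α t} → x ∈ᴬ α → x ∈ᵗ (α · t)
    ·ʳ  : ∀ {α t} → x ∈ᵗ t → x ∈ᵗ (α · t)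
    +ˡ  : ∀ {s t} → x ∈ᵗ s → x ∈ᵗ (s + t)
    +ʳ  : ∀ {s t} → x ∈ᵗ t → x ∈ᵗ (s + t)

  Ground : Term → Set
  Ground t = ∀ x → ¬ (x ∈ᵗ t)

  Linear : Term → Set
  Linear t = ∀ x (p q : x ∈ᵗ t) → p ≡ q

  data Classical : Term → Set where
    var : ∀ x → Classical (var x)
    app : ∀ b {ts} → All Classical ts → Classical (app b ts)

  data Pattern : Term → Set where
    var : ∀ x → Pattern (var x)
    con : ∀ c {ts} → All Pattern ts → Pattern (app (con c) ts)

  data Value : Term → Set where
    con : ∀ c {ts} → All Value ts → Value (app (con c) ts)
    _·_ : ∀ {α t} → GroundAmp α → Value t → Value (α · t)
    _+_ : ∀ {s t} → Value s → Value t → Value (s + t)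

  record Substitution : Set where
    field
      map    : 𝒳 → Term
      values : ∀ x → Value (map x)
  open Substitution public

  ⌜_⌝ : Nat → Term
  ⌜ var x ⌝ = var x
  ⌜ zero  ⌝ = app (con zero) []
  ⌜ suc ι ⌝ = app (con suc) (⌜ ι ⌝ ∷ [])

  -- Substitution is partial, since a variable occurring in an amplitude
  -- may only be replaced by a natural:  t [ σ ]≐ u  says that tσ is a
  -- term and equals u.

  data _[_]≐ᴺ_ : Nat → Substitution → Nat → Set where
    var  : ∀ {x σ ι} → map σ x ≡ ⌜ ι ⌝ → var x [ σ ]≐ᴺ ι
    zero : ∀ {σ} → zero [ σ ]≐ᴺ zero
    suc  : ∀ {σ ι κ} → ι [ σ ]≐ᴺ κ → suc ι [ σ ]≐ᴺ suc κ

  data _[_]≐ᴬ_ : Amp → Substitution → Amp → Set where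
    amp : ∀ {a σ ιs κs} → Pointwise (λ ι κ → ι [ σ ]≐ᴺ κ) ιs κs → amp a ιs [ σ ]≐ᴬ amp a κs
    _⊙_ : ∀ {σ α α′ β β′} → α [ σ ]≐ᴬ α′ → β [ σ ]≐ᴬ β′ → (α ⊙ β) [ σ ]≐ᴬ (α′ ⊙ β′)
    _⊕_ : ∀ {σ α α′ β β′} → α [ σ ]≐ᴬ α′ → β [ σ ]≐ᴬ β′ → (α ⊕ β) [ σ ]≐ᴬ (α′ ⊕ β′)

  data _[_]≐_ : Term → Substitution → Term → Set where
    var : ∀ {x σ} → var x [ σ ]≐ map σ x
    app : ∀ {b σ ts us} → Pointwise (λ t u → t [ σ ]≐ u) ts us → app b ts [ σ ]≐ app b us
    _·_ : ∀ {σ α α′ t t′} → α [ σ ]≐ᴬ α′ → t [ σ ]≐ t′ → (α · t) [ σ ]≐ (α′ · t′)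
    _+_ : ∀ {σ s s′ t t′} → s [ σ ]≐ s′ → t [ σ ]≐ t′ → (s + t) [ σ ]≐ (s′ + t′)

  infix 4 _denotes_
  _denotes_ : Amp → ℂ → Set
  α denotes z = ∀ σ α′ → α [ σ ]≐ᴬ α′ → (g : GroundAmp α′) → ⟦ α′ ⟧ᴬ g ≈ z

  -- In  app b ts i C  the hole lies in argument i, and the i-th entry of
  -- ts is irrelevant.
  data Context : Set where
    ◇   : Context
    app : (b : Symbol) → Vec Term (arity b) → Fin (arity b) → Context → Context
    _·_ : Amp → Context → Context
    +ˡ  : Context → Term → Context
    +ʳ  : Term → Context → Context

  infix 9 _⟨_⟩
  _⟨_⟩ : Context → Term → Term
  ◇            ⟨ s ⟩ = s
  app b ts i C ⟨ s ⟩ = app b (ts [ i ]≔ (C ⟨ s ⟩))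
  (α · C)      ⟨ s ⟩ = α · (C ⟨ s ⟩)
  +ˡ C t       ⟨ s ⟩ = C ⟨ s ⟩ + t
  +ʳ t C       ⟨ s ⟩ = t + C ⟨ s ⟩

  data Evaluation : Context → Set where
    ◇   : Evaluation ◇
    app : ∀ b ts i {E} → (∀ j → j Fin.< i → Value (lookup ts j)) →
          Evaluation E → Evaluation (app b ts i E)

  infix 4 _≋_
  data _≋_ : Rel Term 0ℓ where
    ≋-refl  : ∀ {t} → t ≋ t
    ≋-sym   : ∀ {s t} → s ≋ t → t ≋ s
    ≋-trans : ∀ {s t u} → s ≋ t → t ≋ u → s ≋ u
    ≋-cong  : ∀ C {s t} → s ≋ t → C ⟨ s ⟩ ≋ C ⟨ t ⟩
    +-comm  : ∀ {s t} → s + t ≋ t + s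
    +-assoc : ∀ {s t u} → s + (t + u) ≋ (s + t) + u
    zero-·  : ∀ {s α t} → α denotes 0ℂ → s + α · t ≋ s
    one-·   : ∀ {α t} → α denotes 1ℂ → α · t ≋ t
    ·-·     : ∀ {α β t} → α · (β · t) ≋ (α ⊙ β) · t
    ·-+     : ∀ {α s t} → α · (s + t) ≋ α · s + α · t
    ⊕-·     : ∀ {α β t} → α · t + β · t ≋ (α ⊕ β) · t
    app-·   : ∀ {b ts i α t} → app b (ts [ i ]≔ (α · t)) ≋ α · app b (ts [ i ]≔ t)
    app-+   : ∀ {b ts i s t} → app b (ts [ i ]≔ (s + t)) ≋ app b (ts [ i ]≔ s) + app b (ts [ i ]≔ t)

  sum : ∀ {n} → (Fin (suc n) → Term) → Term
  sum {zero}  t = t zero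
  sum {suc n} t = t zero + sum (t ∘ suc)

  ∑ : ∀ {n} → (Fin (suc n) → Amp) → (Fin (suc n) → Term) → Term
  ∑ α t = sum λ i → α i · t i

  -- ∑ α t ∈ CAN.  For a non-ground α, the condition [[α]] ≠ 0 is the
  -- negation of [[α]] = 0: some instance of α is non-zero.
  record Canonical {n} (α : Fin (suc n) → Amp) (t : Fin (suc n) → Term) : Set where
    field
      classical : ∀ i → Classical (t i)
      distinct  : Injective _≡_ _≡_ t
      nonzero   : ∀ i → ¬ (α i denotes 0ℂ)

  infix 4 _◁_
  _◁_ : Term → Term → Set
  p ◁ r = ∃[ n ] Σ[ α ∈ (Fin (suc n) → Amp) ] Σ[ t ∈ (Fin (suc n) → Term) ]
            (r ≋ ∑ α t) × Canonical α t × ∃[ i ] t i ≡ p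

  -- Decomposing a term into a canonical form needs t ≋ 1 · t, hence an
  -- amplitude for 1. If, say, all amplitudes are built from one constant a
  -- with [[a]] = 2, then for the single rule f → f + f the right-hand side
  -- has no canonical form, so there is no dependency pair, and yet
  -- a · f → a · (f + f) ≋ (a ⊕ a) · f → ⋯ does not terminate.
  UnitDenotable : Set
  UnitDenotable = ∃[ α ] (α denotes 1ℂ)

  record IsRule (l r : Term) : Set where
    field
      head       : Sym ℱ
      args       : Vec Term (ar ℱ head)
      l≡         : l ≡ app (fun head) args
      patterns   : All Pattern args
      variables  : ∀ x → x ∈ᵗ r → x ∈ᵗ l

  data NonVariable : Term → Set where
    app : ∀ {b ts} → NonVariable (app b ts)

  -- The two rules are renamed apart by using two substitutions. The only
  -- overlap allowed is that of a rule with itself at the root.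
  NonOverlapping : Rel Term 0ℓ → Set
  NonOverlapping _⟶_ = ∀ {l r l′ r′} → l ⟶ r → l′ ⟶ r′ →
    ∀ C {u} → C ⟨ u ⟩ ≡ l → NonVariable u →
    ∀ {σ τ w} → u [ σ ]≐ w → l′ [ τ ]≐ w →
    C ≡ ◇ × l ≡ l′ × r ≡ r′

record STRS : Set₁ where
  field
    alphabet : Alphabet
  open Alphabet alphabet public
  open Terms alphabet using (Term; IsRule; Linear; NonOverlapping)
  field
    ℛ              : Rel Term 0ℓ
    rules          : ∀ {l r} → ℛ l r → IsRule l r
    leftLinear     : ∀ {l r} → ℛ l r → Linear l
    nonOverlapping : NonOverlapping ℛ
    main           : Sym ℱ

module Reduction (R : STRS) where

  open STRS R
  open Terms alphabet public

  infix 4 _→ᶜ_ _→ᴿ_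

  data _→ᶜ_ : Rel Term 0ℓ where
    step : ∀ {l r l′ r′ σ E} → ℛ l r → Evaluation E →
           l [ σ ]≐ l′ → r [ σ ]≐ r′ →
           Ground (E ⟨ l′ ⟩) → Classical (E ⟨ l′ ⟩) →
           E ⟨ l′ ⟩ →ᶜ E ⟨ r′ ⟩

  NFᶜ : Term → Set
  NFᶜ s = Ground s × ¬ (∃[ t ] s →ᶜ t)

  -- (Q) refers, negatively, to the normal forms of the relation being
  -- defined, but only for the classical terms s i. Since canonical forms
  -- are unique up to their amplitudes, a ground classical term is
  -- reducible iff it is reducible by →ᶜ, so that NFᶜ and NF agree on
  -- ground classical terms; using NFᶜ in (Q) makes the definition a
  -- well-formed induction.
  data _→ᴿ_ : Rel Term 0ℓ where
    C : ∀ {s t} → s →ᶜ t → s →ᴿ t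
    E : ∀ {s s′ t′ t} → Ground s → Ground t →
        s ≋ s′ → s′ →ᴿ t′ → t′ ≋ t → s →ᴿ t
    Q : ∀ {n} {α : Fin (suc n) → Amp} {s t : Fin (suc n) → Term} →
        Canonical α s → Ground (∑ α s) →
        (∀ i → (NFᶜ (s i) × t i ≡ s i) ⊎ (s i →ᴿ t i)) →
        (∃[ i ] s i →ᴿ t i) →
        ∑ α s →ᴿ ∑ α t

  NF : Term → Set
  NF s = Ground s × ¬ (∃[ t ] s →ᴿ t)

  ReachesNFWithin : ℕ → Term → Set
  ReachesNFWithin zero    s = NF s
  ReachesNFWithin (suc k) s = ∀ t → s →ᴿ t → ReachesNFWithin k t

  Terminating : Set
  Terminating = ∀ s → Ground s → ∃[ k ] ReachesNFWithin k s

module DependencyPairs (R : STRS) where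

  open STRS R
  open Terms alphabet
  module ♯ = Terms (alphabet ♯)

  mutual
    embed : Term → ♯.Term
    embed (var x)          = ♯.var x
    embed (app (con c) ts) = ♯.app (♯.con c) (embeds ts)
    embed (app (fun f) ts) = ♯.app (♯.fun (inj₁ f)) (embeds ts)
    embed (α · t)          = α ♯.· embed t
    embed (s + t)          = embed s ♯.+ embed t

    embeds : ∀ {n} → Vec Term n → Vec ♯.Term n
    embeds []       = []
    embeds (t ∷ ts) = embed t ∷ embeds ts

  tuple : (f : Sym ℱ) → Vec Term (ar ℱ f) → ♯.Term
  tuple f ts = ♯.app (♯.fun (inj₂ f)) (embeds ts)

  data DependencyPair : Rel ♯.Term 0ℓ where
    ⟨_,_⟩ : ∀ {f ss r C g ts} → ℛ (app (fun f) ss) r → C ⟨ app (fun g) ts ⟩ ◁ r →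
            DependencyPair (tuple f ss) (tuple g ts)

-- Relations on classical terms are relations on all terms of which only
-- the restriction to classical terms matters.
module Orders (S : Alphabet) where

  open Terms S

  Strict : Rel Term 0ℓ → Rel Term 0ℓ
  Strict _⪰_ s t = (s ⪰ t) × ¬ (t ⪰ s)

  record IsQuasiOrder (_⪰_ : Rel Term 0ℓ) : Set where
    field
      reflexive  : ∀ {s} → Classical s → s ⪰ s
      transitive : ∀ {s t u} → Classical s → Classical t → Classical u →
                   s ⪰ t → t ⪰ u → s ⪰ u

  WellFounded : Rel Term 0ℓ → Set
  WellFounded _⪰_ = ¬ (Σ[ t ∈ (ℕ → Term) ]
    (∀ n → Classical (t n)) × (∀ n → Strict _⪰_ (t n) (t (suc n))))

  WeaklyMonotonic : Rel Term 0ℓ → Set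
  WeaklyMonotonic _⪰_ = ∀ b {ts} i {s t} → All Classical ts → Classical s → Classical t →
    s ⪰ t → app b (ts [ i ]≔ s) ⪰ app b (ts [ i ]≔ t)

  ClosedUnderSubstitution : Rel Term 0ℓ → Set
  ClosedUnderSubstitution _∼_ = ∀ σ → (∀ x → Classical (map σ x)) →
    ∀ {s t s′ t′} → Classical s → Classical t → s ∼ t →
    s [ σ ]≐ s′ → t [ σ ]≐ t′ → s′ ∼ t′

{-# OPTIONS --safe #-}
-- Evaluating amplitudes turns a term into a finite linear combination of classical
-- terms, and the coefficient of a classical term is invariant under ≋. A reduction
-- step replaces every reducible term p of the support by the support of the reduct of
-- p, and these new terms are obtained from p by contracting a redex lσ to cσ for
-- some c ◁ r. This classical relation ⇝ terminates by the dependency pair argument: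
-- values are irreducible, so in cσ only function calls stemming from c matter, and
-- their tuple terms are smaller than that of lσ. Since →ᶜ is deterministic and
-- supports are finite, ⇝ has a finite height above each classical term, and the
-- maximal height over the support of a term bounds the number of its reduction steps.
module Submission where

open import Defs
open import Algebra.Bundles using (CommutativeSemiring)
import Algebra.Properties.CommutativeSemigroup as CommutativeSemigroupProperties
open import Algebra.Structures.Biased using (isCommutativeSemiringˡ)
open import Axiom.ExcludedMiddle using (ExcludedMiddle)
open import Data.Empty using (⊥-elim)
open import Data.Fin as Fin using (Fin; zero; suc)
import Data.Fin.Properties as Fin
open import Data.List using (List; []; _∷_)
open import Data.List.Membership.Propositional using (_∈_; _∉_)
open import Data.List.Relation.Unary.Any using (here; there)
open import Data.Nat as ℕ using (ℕ; zero; suc)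
import Data.Nat.Properties as ℕ
open import Data.Product using (Σ-syntax; ∃-syntax; _×_; _,_; proj₁; proj₂)
open import Data.Rational as ℚ using (0ℚ; 1ℚ)
import Data.Rational.Properties as ℚ
open import Data.Rational.Solver using (module +-*-Solver)
open import Data.Sum using (_⊎_; inj₁; inj₂; [_,_]′)
open import Data.Unit using (⊤; tt)
open import Data.Vec as Vec using (Vec; []; _∷_; lookup; _[_]≔_)
import Data.Vec.Functional as Vector
open import Data.Vec.Properties using ([]≔-idempotent; []≔-lookup; lookup∘update; lookup∘update′)
open import Data.Vec.Relation.Binary.Pointwise.Inductive using (Pointwise; []; _∷_)
open import Data.Vec.Relation.Unary.All using (All; []; _∷_)
open import Data.Vec.Relation.Unary.All.Properties using () renaming (lookup⁺ to All-lookup)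
open import Data.Vec.Relation.Unary.Any using (Any; here; there)
open import Function.Base using (_∘_; flip)
open import Function.Definitions using (Injective)
open import Induction.WellFounded using (Acc; acc; acc-inverse)
open import Level using (0ℓ)
open import Relation.Binary.Core using (Rel)
open import Relation.Binary.Definitions using (tri<; tri≈; tri>)
open import Relation.Binary.PropositionalEquality using (_≡_; _≢_; refl; sym; trans; cong; cong₂; subst; subst₂)
open import Relation.Binary.Structures using (IsEquivalence)
open import Relation.Nullary using (¬_; Dec; yes; no; contradiction)

-- The complex numbers as a commutative semiring

open +-*-Solver using (solve; _:=_; _:+_; _:*_; _:-_; :-_) renaming (con to const)

-- The obstacle is that `≋` creates and deletes summands of amplitude zero, splits amplitudes and
-- merges equal terms, so no measure can be read off the shape of a term. The coefficient of a
-- classical term is respected by `≋`, but right-hand sides of rules need care: `r` may have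
-- variables inside amplitudes, where substitution is partial, so a derivation of `r ≋ ∑ α c` cannot
-- simply be instantiated, since its intermediate terms may have no instance. Coefficients are
-- therefore defined for open terms, relative to a reading of the variables as numbers inside
-- amplitudes and as terms elsewhere; instantiating `r` then amounts to changing the reading.
-- Amplitudes that cancel or vanish under a reading can only remove terms from a support, so
-- inclusions between supports are enough. The maximum of the heights, rather than their sum, bounds
-- the number of steps because (Q) moves every reducible summand at once. Excluded middle decides
-- equality of terms and symbols and the vanishing of amplitudes.

∣-∣-sum-< : ∀ a b {c d ε} → c ℚ.+ d ≡ ε → ℚ.∣ a ∣ ℚ.< c → ℚ.∣ b ∣ ℚ.< d → ℚ.∣ a ℚ.+ b ∣ ℚ.< ε
∣-∣-sum-< a b refl a<c b<d = ℚ.≤-<-trans (ℚ.∣p+q∣≤∣p∣+∣q∣ a b) (ℚ.+-mono-< a<c b<d)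

halve : ∀ ε → 0ℚ ℚ.< ε → ∃[ δ ] (0ℚ ℚ.< δ × δ ℚ.+ δ ≡ ε)
halve ε 0<ε =
  ℚ.½ ℚ.* ε ,
  ℚ.positive⁻¹ (ℚ.½ ℚ.* ε) {{ℚ.pos*pos⇒pos ℚ.½ ε {{ℚ.positive 0<ε}}}} ,
  solve 1 (λ e → const ℚ.½ :* e :+ const ℚ.½ :* e := e) refl ε

divide : ∀ ε B → 0ℚ ℚ.< ε → 0ℚ ℚ.< B → ∃[ δ ] (0ℚ ℚ.< δ × B ℚ.* δ ≡ ε)
divide ε B 0<ε 0<B =
  ℚ.1/ B ℚ.* ε ,
  ℚ.positive⁻¹ _ {{ℚ.pos*pos⇒pos (ℚ.1/ B) {{ℚ.1/pos⇒pos B}} ε}} ,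
  trans (sym (ℚ.*-assoc B (ℚ.1/ B) ε)) (trans (cong (ℚ._* ε) (ℚ.*-inverseʳ B)) (ℚ.*-identityˡ ε))
  where
  instance
    ε-positive = ℚ.positive 0<ε
    B-positive = ℚ.positive 0<B
    B-nonZero  = ℚ.pos⇒nonZero B

pointwise⇒≈ᴿ : ∀ {x y} → (∀ n → seq x n ≡ seq y n) → x ≈ᴿ y
pointwise⇒≈ᴿ {x} {y} eq ε 0<ε = 0 , λ n _ →
  subst (λ q → ℚ.∣ q ∣ ℚ.< ε)
    (sym (trans (cong (ℚ._- seq y n) (eq n)) (ℚ.+-inverseʳ (seq y n)))) 0<ε

≈ᴿ-sym : ∀ {x y} → x ≈ᴿ y → y ≈ᴿ x
≈ᴿ-sym {x} {y} x≈y ε 0<ε = let N , close = x≈y ε 0<ε in N , λ n N≤n →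
  subst (ℚ._< ε)
    (trans (sym (ℚ.∣-p∣≡∣p∣ (seq x n ℚ.- seq y n)))
      (cong ℚ.∣_∣ (solve 2 (λ a b → :- (a :- b) := b :- a) refl (seq x n) (seq y n))))
    (close n N≤n)

≈ᴿ-trans : ∀ {x y z} → x ≈ᴿ y → y ≈ᴿ z → x ≈ᴿ z
≈ᴿ-trans {x} {y} {z} x≈y y≈z ε 0<ε =
  let δ , 0<δ , eq = halve ε 0<ε
      M , close₁ = x≈y δ 0<δ
      N , close₂ = y≈z δ 0<δ
  in M ℕ.⊔ N , λ n M⊔N≤n → subst (λ q → ℚ.∣ q ∣ ℚ.< ε)
    (solve 3 (λ a b c → (a :- b) :+ (b :- c) := a :- c) refl (seq x n) (seq y n) (seq z n))
    (∣-∣-sum-< (seq x n ℚ.- seq y n) (seq y n ℚ.- seq z n) eq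
      (close₁ n (ℕ.m⊔n≤o⇒m≤o M N M⊔N≤n)) (close₂ n (ℕ.m⊔n≤o⇒n≤o M N M⊔N≤n)))

+ᴿ-cong : ∀ {x x′ y y′} → x ≈ᴿ x′ → y ≈ᴿ y′ → x +ᴿ y ≈ᴿ x′ +ᴿ y′
+ᴿ-cong {x} {x′} {y} {y′} x≈x′ y≈y′ ε 0<ε =
  let δ , 0<δ , eq = halve ε 0<ε
      M , close₁ = x≈x′ δ 0<δ
      N , close₂ = y≈y′ δ 0<δ
  in M ℕ.⊔ N , λ n M⊔N≤n → subst (λ q → ℚ.∣ q ∣ ℚ.< ε)
    (solve 4 (λ a a′ b b′ → (a :- a′) :+ (b :- b′) := (a :+ b) :- (a′ :+ b′)) refl
      (seq x n) (seq x′ n) (seq y n) (seq y′ n))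
    (∣-∣-sum-< (seq x n ℚ.- seq x′ n) (seq y n ℚ.- seq y′ n) eq
      (close₁ n (ℕ.m⊔n≤o⇒m≤o M N M⊔N≤n)) (close₂ n (ℕ.m⊔n≤o⇒n≤o M N M⊔N≤n)))

-ᴿ-cong : ∀ {x y} → x ≈ᴿ y → -ᴿ x ≈ᴿ -ᴿ y
-ᴿ-cong {x} {y} x≈y ε 0<ε = let N , close = x≈y ε 0<ε in N , λ n N≤n →
  subst (ℚ._< ε)
    (trans (sym (ℚ.∣-p∣≡∣p∣ (seq x n ℚ.- seq y n)))
      (cong ℚ.∣_∣ (solve 2 (λ a b → :- (a :- b) := (:- a) :- (:- b)) refl (seq x n) (seq y n))))
    (close n N≤n)

eventually-bounded : ∀ x → ∃[ B ] (0ℚ ℚ.< B × ∃[ N ] (∀ n → N ℕ.≤ n → ℚ.∣ seq x n ∣ ℚ.≤ B))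
eventually-bounded x = let N , close = cauchy x 1ℚ (ℚ.positive⁻¹ 1ℚ) in
  1ℚ ℚ.+ ℚ.∣ seq x N ∣ ,
  ℚ.positive⁻¹ _ {{ℚ.pos+nonNeg⇒pos 1ℚ ℚ.∣ seq x N ∣ {{ℚ.∣-∣-nonNeg (seq x N)}}}} ,
  N , λ n N≤n → subst (λ q → ℚ.∣ q ∣ ℚ.≤ 1ℚ ℚ.+ ℚ.∣ seq x N ∣)
    (solve 2 (λ a b → (a :- b) :+ b := a) refl (seq x n) (seq x N))
    (ℚ.≤-trans (ℚ.∣p+q∣≤∣p∣+∣q∣ (seq x n ℚ.- seq x N) (seq x N))
      (ℚ.+-monoˡ-≤ ℚ.∣ seq x N ∣ (ℚ.<⇒≤ (close n N N≤n ℕ.≤-refl))))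

*ᴿ-congˡ : ∀ z {x y} → x ≈ᴿ y → z *ᴿ x ≈ᴿ z *ᴿ y
*ᴿ-congˡ z {x} {y} x≈y ε 0<ε =
  let B , 0<B , M , bound = eventually-bounded z
      -- The factor `z` is eventually bounded by `B`, so a difference below `δ` = ε / B is scaled to
      -- one below ε.
      δ , 0<δ , eq = divide ε B 0<ε 0<B
      N , close = x≈y δ 0<δ
  in M ℕ.⊔ N , λ n M⊔N≤n →
    let a = seq z n
        d = seq x n ℚ.- seq y n
    in subst₂ ℚ._<_
      (trans (sym (ℚ.∣p*q∣≡∣p∣*∣q∣ a d))
        (cong ℚ.∣_∣ (solve 3 (λ a b c → a :* (b :- c) := a :* b :- a :* c) refl a (seq x n) (seq y n))))
      eq
      (ℚ.≤-<-trans
        (ℚ.*-monoʳ-≤-nonNeg ℚ.∣ d ∣ {{ℚ.∣-∣-nonNeg d}} (bound n (ℕ.m⊔n≤o⇒m≤o M N M⊔N≤n)))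
        (ℚ.*-monoʳ-<-pos B {{ℚ.positive 0<B}} (close n (ℕ.m⊔n≤o⇒n≤o M N M⊔N≤n))))

*ᴿ-cong : ∀ {x x′ y y′} → x ≈ᴿ x′ → y ≈ᴿ y′ → x *ᴿ y ≈ᴿ x′ *ᴿ y′
*ᴿ-cong {x} {x′} {y} {y′} x≈x′ y≈y′ =
  ≈ᴿ-trans {x *ᴿ y} {x *ᴿ y′} {x′ *ᴿ y′} (*ᴿ-congˡ x {y} {y′} y≈y′)
    (≈ᴿ-trans {x *ᴿ y′} {y′ *ᴿ x} {x′ *ᴿ y′} (comm x y′)
      (≈ᴿ-trans {y′ *ᴿ x} {y′ *ᴿ x′} {x′ *ᴿ y′} (*ᴿ-congˡ y′ {x} {x′} x≈x′) (comm y′ x′)))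
  where
  comm : ∀ x y → x *ᴿ y ≈ᴿ y *ᴿ x
  comm x y = pointwise⇒≈ᴿ {x *ᴿ y} {y *ᴿ x} λ n → ℚ.*-comm (seq x n) (seq y n)

+ᶜ-cong : ∀ {w w′ z z′} → w ≈ w′ → z ≈ z′ → (w +ᶜ z) ≈ (w′ +ᶜ z′)
+ᶜ-cong {w} {w′} {z} {z′} (p , p′) (q , q′) =
  +ᴿ-cong {re w} {re w′} {re z} {re z′} p q , +ᴿ-cong {im w} {im w′} {im z} {im z′} p′ q′

*ᶜ-cong : ∀ {w w′ z z′} → w ≈ w′ → z ≈ z′ → (w *ᶜ z) ≈ (w′ *ᶜ z′)
*ᶜ-cong {a +i b} {a′ +i b′} {c +i d} {c′ +i d′} (p , p′) (q , q′) =
  +ᴿ-cong {a *ᴿ c} {a′ *ᴿ c′} { -ᴿ (b *ᴿ d)} { -ᴿ (b′ *ᴿ d′)}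
    (*ᴿ-cong {a} {a′} {c} {c′} p q)
    (-ᴿ-cong {b *ᴿ d} {b′ *ᴿ d′} (*ᴿ-cong {b} {b′} {d} {d′} p′ q′)) ,
  +ᴿ-cong {a *ᴿ d} {a′ *ᴿ d′} {b *ᴿ c} {b′ *ᴿ c′}
    (*ᴿ-cong {a} {a′} {d} {d′} p q′) (*ᴿ-cong {b} {b′} {c} {c′} p′ q)

pointwise⇒≈ : ∀ {w z} → (∀ n → seq (re w) n ≡ seq (re z) n) → (∀ n → seq (im w) n ≡ seq (im z) n) → w ≈ z
pointwise⇒≈ {w} {z} p q = pointwise⇒≈ᴿ {re w} {re z} p , pointwise⇒≈ᴿ {im w} {im z} q

-- Each law is a ring identity in every entry of the rational sequences; estimates enter only
-- through transitivity and the congruences.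
ℂ-commutativeSemiring : CommutativeSemiring 0ℓ 0ℓ
ℂ-commutativeSemiring = record
  { Carrier = ℂ ; _≈_ = _≈_ ; _+_ = _+ᶜ_ ; _*_ = _*ᶜ_ ; 0# = 0ℂ ; 1# = 1ℂ
  ; isCommutativeSemiring = isCommutativeSemiringˡ record
    { +-isCommutativeMonoid = record
      { isMonoid = record
        { isSemigroup = record
          { isMagma = record { isEquivalence = isEquivalence ; ∙-cong = λ {w} {w′} {z} {z′} → +ᶜ-cong {w} {w′} {z} {z′} }
          ; assoc = λ u v w → pointwise⇒≈ {(u +ᶜ v) +ᶜ w} {u +ᶜ (v +ᶜ w)}
              (λ n → ℚ.+-assoc (seq (re u) n) (seq (re v) n) (seq (re w) n))
              (λ n → ℚ.+-assoc (seq (im u) n) (seq (im v) n) (seq (im w) n))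
          }
        ; identity =
            (λ w → pointwise⇒≈ {0ℂ +ᶜ w} {w}
              (λ n → ℚ.+-identityˡ (seq (re w) n)) (λ n → ℚ.+-identityˡ (seq (im w) n))) ,
            (λ w → pointwise⇒≈ {w +ᶜ 0ℂ} {w}
              (λ n → ℚ.+-identityʳ (seq (re w) n)) (λ n → ℚ.+-identityʳ (seq (im w) n)))
        }
      ; comm = λ w z → pointwise⇒≈ {w +ᶜ z} {z +ᶜ w}
          (λ n → ℚ.+-comm (seq (re w) n) (seq (re z) n)) (λ n → ℚ.+-comm (seq (im w) n) (seq (im z) n))
      }
    ; *-isCommutativeMonoid = record
      { isMonoid = record
        { isSemigroup = record
          { isMagma = record { isEquivalence = isEquivalence ; ∙-cong = λ {w} {w′} {z} {z′} → *ᶜ-cong {w} {w′} {z} {z′} }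
          ; assoc = λ u v w → pointwise⇒≈ {(u *ᶜ v) *ᶜ w} {u *ᶜ (v *ᶜ w)}
              (λ n → solve 6 (λ a b c d e f →
                  (a :* c :+ :- (b :* d)) :* e :+ :- ((a :* d :+ b :* c) :* f) :=
                  a :* (c :* e :+ :- (d :* f)) :+ :- (b :* (c :* f :+ d :* e))) refl
                (seq (re u) n) (seq (im u) n) (seq (re v) n) (seq (im v) n) (seq (re w) n) (seq (im w) n))
              (λ n → solve 6 (λ a b c d e f →
                  (a :* c :+ :- (b :* d)) :* f :+ (a :* d :+ b :* c) :* e :=
                  a :* (c :* f :+ d :* e) :+ b :* (c :* e :+ :- (d :* f))) refl
                (seq (re u) n) (seq (im u) n) (seq (re v) n) (seq (im v) n) (seq (re w) n) (seq (im w) n))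
          }
        ; identity =
            (λ w → pointwise⇒≈ {1ℂ *ᶜ w} {w}
              (λ n → solve 2 (λ a b → const 1ℚ :* a :+ :- (const 0ℚ :* b) := a) refl
                (seq (re w) n) (seq (im w) n))
              (λ n → solve 2 (λ a b → const 1ℚ :* b :+ const 0ℚ :* a := b) refl
                (seq (re w) n) (seq (im w) n))) ,
            (λ w → pointwise⇒≈ {w *ᶜ 1ℂ} {w}
              (λ n → solve 2 (λ a b → a :* const 1ℚ :+ :- (b :* const 0ℚ) := a) refl
                (seq (re w) n) (seq (im w) n))
              (λ n → solve 2 (λ a b → a :* const 0ℚ :+ b :* const 1ℚ := b) refl
                (seq (re w) n) (seq (im w) n)))
        }
      ; comm = λ w z → pointwise⇒≈ {w *ᶜ z} {z *ᶜ w}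
          (λ n → solve 4 (λ a b c d → a :* c :+ :- (b :* d) := c :* a :+ :- (d :* b)) refl
            (seq (re w) n) (seq (im w) n) (seq (re z) n) (seq (im z) n))
          (λ n → solve 4 (λ a b c d → a :* d :+ b :* c := c :* b :+ d :* a) refl
            (seq (re w) n) (seq (im w) n) (seq (re z) n) (seq (im z) n))
      }
    ; distribʳ = λ u v w → pointwise⇒≈ {(v +ᶜ w) *ᶜ u} {(v *ᶜ u) +ᶜ (w *ᶜ u)}
        (λ n → solve 6 (λ a b c d e f →
            (c :+ e) :* a :+ :- ((d :+ f) :* b) := (c :* a :+ :- (d :* b)) :+ (e :* a :+ :- (f :* b))) refl
          (seq (re u) n) (seq (im u) n) (seq (re v) n) (seq (im v) n) (seq (re w) n) (seq (im w) n))
        (λ n → solve 6 (λ a b c d e f →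
            (c :+ e) :* b :+ (d :+ f) :* a := (c :* b :+ d :* a) :+ (e :* b :+ f :* a)) refl
          (seq (re u) n) (seq (im u) n) (seq (re v) n) (seq (im v) n) (seq (re w) n) (seq (im w) n))
    ; zeroˡ = λ w → pointwise⇒≈ {0ℂ *ᶜ w} {0ℂ}
        (λ n → solve 2 (λ a b → const 0ℚ :* a :+ :- (const 0ℚ :* b) := const 0ℚ) refl
          (seq (re w) n) (seq (im w) n))
        (λ n → solve 2 (λ a b → const 0ℚ :* b :+ const 0ℚ :* a := const 0ℚ) refl
          (seq (re w) n) (seq (im w) n))
    }
  }
  where
  isEquivalence : IsEquivalence _≈_
  isEquivalence = record
    { refl  = λ {w} → pointwise⇒≈ {w} {w} (λ _ → refl) (λ _ → refl)
    ; sym   = λ {w} {z} (p , q) → ≈ᴿ-sym {re w} {re z} p , ≈ᴿ-sym {im w} {im z} q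
    ; trans = λ {u} {v} {w} (p , q) (p′ , q′) →
        ≈ᴿ-trans {re u} {re v} {re w} p p′ , ≈ᴿ-trans {im u} {im v} {im w} q q′
    }

1ℂ≉0ℂ : ¬ (1ℂ ≈ 0ℂ)
1ℂ≉0ℂ (1≈0 , _) = let N , close = 1≈0 1ℚ (ℚ.positive⁻¹ 1ℚ) in ℚ.<-irrefl refl (close N ℕ.≤-refl)

-- Substitutions

module _ {A : Set} {P : A → Set} where

  All-update : ∀ {n} {xs : Vec A n} i {x} → All P xs → P x → All P (xs [ i ]≔ x)
  All-update zero    (_ ∷ ps) p = p ∷ ps
  All-update (suc i) (q ∷ ps) p = q ∷ All-update i ps p

  Any-update : ∀ {n} (xs : Vec A n) i {x} → P x → Any P (xs [ i ]≔ x)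
  Any-update (_ ∷ xs) zero    p = here p
  Any-update (_ ∷ xs) (suc i) p = there (Any-update xs i p)

  Any-update⁻ : ∀ {n} (xs : Vec A n) i {x} y → Any P (xs [ i ]≔ x) → P x ⊎ Any P (xs [ i ]≔ y)
  Any-update⁻ (_ ∷ xs) zero    y (here p)  = inj₁ p
  Any-update⁻ (_ ∷ xs) zero    y (there p) = inj₂ (there p)
  Any-update⁻ (_ ∷ xs) (suc i) y (here p)  = inj₂ (here p)
  Any-update⁻ (_ ∷ xs) (suc i) y (there p) = [ inj₁ , inj₂ ∘ there ]′ (Any-update⁻ xs i y p)

module Substitutions (S : Alphabet) where

  open Alphabet S
  open Terms S

  private
    variable
      σ τ : Substitution

  ⌜⌝-injective : ∀ ι κ → ⌜ ι ⌝ ≡ ⌜ κ ⌝ → ι ≡ κ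
  ⌜⌝-injective (var x) (var .x) refl = refl
  ⌜⌝-injective zero    zero     refl = refl
  ⌜⌝-injective (suc ι) (suc κ)  eq   = cong suc (⌜⌝-injective ι κ (arg eq))
    where
    arg : ∀ {s t} → app (con suc) (s ∷ []) ≡ app (con suc) (t ∷ []) → s ≡ t
    arg refl = refl

  app-injective : ∀ {b b′ ts us} → Term.app b ts ≡ app b′ us → Σ[ eq ∈ b ≡ b′ ] subst (Vec Term ∘ arity) eq ts ≡ us
  app-injective refl = refl , refl

  pattern⇒classical : ∀ {t} → Pattern t → Classical t
  patterns⇒classical : ∀ {n} {ts : Vec Term n} → All Pattern ts → All Classical ts
  pattern⇒classical (var x)    = var x
  pattern⇒classical (con c ps) = app (con c) (patterns⇒classical ps)
  patterns⇒classical []       = []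
  patterns⇒classical (p ∷ ps) = pattern⇒classical p ∷ patterns⇒classical ps

  ≐ᴺ-unique : ∀ {ι κ κ′} → ι [ σ ]≐ᴺ κ → ι [ σ ]≐ᴺ κ′ → κ ≡ κ′
  ≐ᴺ-unique (var eq) (var eq′) = ⌜⌝-injective _ _ (trans (sym eq) eq′)
  ≐ᴺ-unique zero     zero      = refl
  ≐ᴺ-unique (suc p)  (suc q)   = cong suc (≐ᴺ-unique p q)

  ≐ᴺˢ-unique : ∀ {n} {ιs κs κs′ : Vec Nat n} → Pointwise (λ ι κ → ι [ σ ]≐ᴺ κ) ιs κs →
    Pointwise (λ ι κ → ι [ σ ]≐ᴺ κ) ιs κs′ → κs ≡ κs′
  ≐ᴺˢ-unique []       []       = refl
  ≐ᴺˢ-unique (p ∷ ps) (q ∷ qs) = cong₂ _∷_ (≐ᴺ-unique p q) (≐ᴺˢ-unique ps qs)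

  ≐ᴬ-unique : ∀ {α β β′} → α [ σ ]≐ᴬ β → α [ σ ]≐ᴬ β′ → β ≡ β′
  ≐ᴬ-unique (amp ps) (amp qs)  = cong (amp _) (≐ᴺˢ-unique ps qs)
  ≐ᴬ-unique (p ⊙ p′) (q ⊙ q′) = cong₂ _⊙_ (≐ᴬ-unique p q) (≐ᴬ-unique p′ q′)
  ≐ᴬ-unique (p ⊕ p′) (q ⊕ q′) = cong₂ _⊕_ (≐ᴬ-unique p q) (≐ᴬ-unique p′ q′)

  mutual
    ≐-unique : ∀ {t u u′} → t [ σ ]≐ u → t [ σ ]≐ u′ → u ≡ u′
    ≐-unique var      var      = refl
    ≐-unique (app ps) (app qs) = cong (app _) (≐ˢ-unique ps qs)
    ≐-unique (p · p′) (q · q′) = cong₂ _·_ (≐ᴬ-unique p q) (≐-unique p′ q′)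
    ≐-unique (p + p′) (q + q′) = cong₂ _+_ (≐-unique p q) (≐-unique p′ q′)

    ≐ˢ-unique : ∀ {n} {ts us us′ : Vec Term n} → Pointwise (λ t u → t [ σ ]≐ u) ts us →
      Pointwise (λ t u → t [ σ ]≐ u) ts us′ → us ≡ us′
    ≐ˢ-unique []       []       = refl
    ≐ˢ-unique (p ∷ ps) (q ∷ qs) = cong₂ _∷_ (≐-unique p q) (≐ˢ-unique ps qs)

  ≐ᴺ-agree : ∀ {ι κ} → (∀ x → x ∈ᴺ ι → map σ x ≡ map τ x) → ι [ σ ]≐ᴺ κ → ι [ τ ]≐ᴺ κ
  ≐ᴺ-agree agree (var eq) = var (trans (sym (agree _ var)) eq)
  ≐ᴺ-agree agree zero     = zero
  ≐ᴺ-agree agree (suc p)  = suc (≐ᴺ-agree (λ x → agree x ∘ suc) p)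

  ≐ᴺˢ-agree : ∀ {n} {ιs κs : Vec Nat n} → (∀ x → Any (x ∈ᴺ_) ιs → map σ x ≡ map τ x) →
    Pointwise (λ ι κ → ι [ σ ]≐ᴺ κ) ιs κs → Pointwise (λ ι κ → ι [ τ ]≐ᴺ κ) ιs κs
  ≐ᴺˢ-agree agree []       = []
  ≐ᴺˢ-agree agree (p ∷ ps) =
    ≐ᴺ-agree (λ x → agree x ∘ here) p ∷ ≐ᴺˢ-agree (λ x → agree x ∘ there) ps

  ≐ᴬ-agree : ∀ {α β} → (∀ x → x ∈ᴬ α → map σ x ≡ map τ x) → α [ σ ]≐ᴬ β → α [ τ ]≐ᴬ β
  ≐ᴬ-agree agree (amp ps) = amp (≐ᴺˢ-agree (λ x → agree x ∘ amp) ps)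
  ≐ᴬ-agree agree (p ⊙ q)  = ≐ᴬ-agree (λ x → agree x ∘ ⊙ˡ) p ⊙ ≐ᴬ-agree (λ x → agree x ∘ ⊙ʳ) q
  ≐ᴬ-agree agree (p ⊕ q)  = ≐ᴬ-agree (λ x → agree x ∘ ⊕ˡ) p ⊕ ≐ᴬ-agree (λ x → agree x ∘ ⊕ʳ) q

  mutual
    ≐-agree : ∀ {t u} → (∀ x → x ∈ᵗ t → map σ x ≡ map τ x) → t [ σ ]≐ u → t [ τ ]≐ u
    ≐-agree {τ = τ} agree (var {x}) = subst (var x [ τ ]≐_) (sym (agree x var)) var
    ≐-agree agree (app ps) = app (≐ˢ-agree (λ x → agree x ∘ app) ps)
    ≐-agree agree (p · q)  = ≐ᴬ-agree (λ x → agree x ∘ ·ˡ) p · ≐-agree (λ x → agree x ∘ ·ʳ) q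
    ≐-agree agree (p + q)  = ≐-agree (λ x → agree x ∘ +ˡ) p + ≐-agree (λ x → agree x ∘ +ʳ) q

    ≐ˢ-agree : ∀ {n} {ts us : Vec Term n} → (∀ x → Any (x ∈ᵗ_) ts → map σ x ≡ map τ x) →
      Pointwise (λ t u → t [ σ ]≐ u) ts us → Pointwise (λ t u → t [ τ ]≐ u) ts us
    ≐ˢ-agree agree []       = []
    ≐ˢ-agree agree (p ∷ ps) =
      ≐-agree (λ x → agree x ∘ here) p ∷ ≐ˢ-agree (λ x → agree x ∘ there) ps

  mutual
    -- An instance of a classical term shows the image of each variable at the position where the
    -- variable occurs.
    matching-unique : ∀ {t u x} → Classical t → t [ σ ]≐ u → t [ τ ]≐ u → x ∈ᵗ t → map σ x ≡ map τ x
    matching-unique {σ} {τ} (var x) p q var = trans (≐-unique {σ} var p) (≐-unique {τ} q var)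
    matching-unique (app b cs) (app ps) (app qs) (app m) = matchings-unique cs ps qs m

    matchings-unique : ∀ {n} {ts us : Vec Term n} {x} → All Classical ts →
      Pointwise (λ t u → t [ σ ]≐ u) ts us → Pointwise (λ t u → t [ τ ]≐ u) ts us →
      Any (x ∈ᵗ_) ts → map σ x ≡ map τ x
    matchings-unique (c ∷ cs) (p ∷ ps) (q ∷ qs) (here m)  = matching-unique c p q m
    matchings-unique (c ∷ cs) (p ∷ ps) (q ∷ qs) (there m) = matchings-unique cs ps qs m

  mutual
    ≐-value : ∀ {t u} → Pattern t → t [ σ ]≐ u → Value u
    ≐-value {σ} (var x) var      = values σ x
    ≐-value (con c ps)  (app qs) = con c (≐ˢ-value ps qs)

    ≐ˢ-value : ∀ {n} {ts us : Vec Term n} → All Pattern ts → Pointwise (λ t u → t [ σ ]≐ u) ts us → All Value us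
    ≐ˢ-value []       []       = []
    ≐ˢ-value (p ∷ ps) (q ∷ qs) = ≐-value p q ∷ ≐ˢ-value ps qs

  mutual
    ≐-classical : ∀ {t u} → (∀ x → Classical (map σ x)) → Classical t → t [ σ ]≐ u → Classical u
    ≐-classical σ-classical (var x)    var      = σ-classical x
    ≐-classical σ-classical (app b ps) (app qs) = app b (≐ˢ-classical σ-classical ps qs)

    ≐ˢ-classical : ∀ {n} {ts us : Vec Term n} → (∀ x → Classical (map σ x)) → All Classical ts →
      Pointwise (λ t u → t [ σ ]≐ u) ts us → All Classical us
    ≐ˢ-classical σ-classical []       []       = []
    ≐ˢ-classical σ-classical (p ∷ ps) (q ∷ qs) = ≐-classical σ-classical p q ∷ ≐ˢ-classical σ-classical ps qs

  mutual
    ≐-classical⁻ : ∀ {t u x} → t [ σ ]≐ u → Classical u → x ∈ᵗ t → Classical (map σ x)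
    ≐-classical⁻ var      c          var     = c
    ≐-classical⁻ (app ps) (app b cs) (app m) = ≐ˢ-classical⁻ ps cs m

    ≐ˢ-classical⁻ : ∀ {n} {ts us : Vec Term n} {x} → Pointwise (λ t u → t [ σ ]≐ u) ts us → All Classical us →
      Any (x ∈ᵗ_) ts → Classical (map σ x)
    ≐ˢ-classical⁻ (p ∷ ps) (c ∷ cs) (here m)  = ≐-classical⁻ p c m
    ≐ˢ-classical⁻ (p ∷ ps) (c ∷ cs) (there m) = ≐ˢ-classical⁻ ps cs m

  mutual
    value-ground : ∀ {v} → Value v → Ground v
    value-ground (con c vs) x (app m) = values-ground vs x m
    value-ground (g · v)    x (·ˡ m)  = g x m
    value-ground (g · v)    x (·ʳ m)  = value-ground v x m
    value-ground (v + w)    x (+ˡ m)  = value-ground v x m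
    value-ground (v + w)    x (+ʳ m)  = value-ground w x m

    values-ground : ∀ {n} {vs : Vec Term n} → All Value vs → ∀ x → ¬ Any (x ∈ᵗ_) vs
    values-ground (v ∷ vs) x (here m)  = value-ground v x m
    values-ground (v ∷ vs) x (there m) = values-ground vs x m

  ∈ᴺ⇒∈ᵗ : ∀ {x ι} → x ∈ᴺ ι → x ∈ᵗ ⌜ ι ⌝
  ∈ᴺ⇒∈ᵗ var     = var
  ∈ᴺ⇒∈ᵗ (suc p) = app (here (∈ᴺ⇒∈ᵗ p))

  ≐ᴺ-ground : ∀ {ι κ} → ι [ σ ]≐ᴺ κ → ∀ x → ¬ (x ∈ᴺ κ)
  ≐ᴺ-ground {σ} (var {y} eq) x m       = value-ground (subst Value eq (values σ y)) x (∈ᴺ⇒∈ᵗ m)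
  ≐ᴺ-ground     (suc p)      x (suc m) = ≐ᴺ-ground p x m

  ≐ᴺˢ-ground : ∀ {n} {ιs κs : Vec Nat n} → Pointwise (λ ι κ → ι [ σ ]≐ᴺ κ) ιs κs → ∀ x → ¬ Any (x ∈ᴺ_) κs
  ≐ᴺˢ-ground (p ∷ ps) x (here m)  = ≐ᴺ-ground p x m
  ≐ᴺˢ-ground (p ∷ ps) x (there m) = ≐ᴺˢ-ground ps x m

  ≐ᴬ-ground : ∀ {α β} → α [ σ ]≐ᴬ β → GroundAmp β
  ≐ᴬ-ground (amp ps) x (amp m) = ≐ᴺˢ-ground ps x m
  ≐ᴬ-ground (p ⊙ q)  x (⊙ˡ m)  = ≐ᴬ-ground p x m
  ≐ᴬ-ground (p ⊙ q)  x (⊙ʳ m)  = ≐ᴬ-ground q x m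
  ≐ᴬ-ground (p ⊕ q)  x (⊕ˡ m)  = ≐ᴬ-ground p x m
  ≐ᴬ-ground (p ⊕ q)  x (⊕ʳ m)  = ≐ᴬ-ground q x m

  mutual
    ≐-ground : ∀ {t u} → t [ σ ]≐ u → Ground u
    ≐-ground {σ} (var {y}) x m = value-ground (values σ y) x m
    ≐-ground (app ps) x (app m) = ≐ˢ-ground ps x m
    ≐-ground (p · q)  x (·ˡ m)  = ≐ᴬ-ground p x m
    ≐-ground (p · q)  x (·ʳ m)  = ≐-ground q x m
    ≐-ground (p + q)  x (+ˡ m)  = ≐-ground p x m
    ≐-ground (p + q)  x (+ʳ m)  = ≐-ground q x m

    ≐ˢ-ground : ∀ {n} {ts us : Vec Term n} → Pointwise (λ t u → t [ σ ]≐ u) ts us → ∀ x → ¬ Any (x ∈ᵗ_) us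
    ≐ˢ-ground (p ∷ ps) x (here m)  = ≐-ground p x m
    ≐ˢ-ground (p ∷ ps) x (there m) = ≐ˢ-ground ps x m

  context-ground : ∀ C {s t} → Ground (C ⟨ s ⟩) → Ground t → Ground (C ⟨ t ⟩)
  context-ground C {s} {t} ground-s ground-t x m = [ ground-s x , ground-t x ]′ (replace C m)
    where
    replace : ∀ C → x ∈ᵗ (C ⟨ t ⟩) → x ∈ᵗ (C ⟨ s ⟩) ⊎ x ∈ᵗ t
    replace ◇              m       = inj₂ m
    replace (app b ts i C) (app m) with Any-update⁻ ts i (C ⟨ s ⟩) m
    ... | inj₁ m′ = [ inj₁ ∘ app ∘ Any-update ts i , inj₂ ]′ (replace C m′)
    ... | inj₂ m′ = inj₁ (app m′)
    replace (α · C)  (·ˡ m) = inj₁ (·ˡ m)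
    replace (α · C)  (·ʳ m) = [ inj₁ ∘ ·ʳ , inj₂ ]′ (replace C m)
    replace (+ˡ C u) (+ˡ m) = [ inj₁ ∘ +ˡ , inj₂ ]′ (replace C m)
    replace (+ˡ C u) (+ʳ m) = inj₁ (+ʳ m)
    replace (+ʳ u C) (+ˡ m) = inj₁ (+ˡ m)
    replace (+ʳ u C) (+ʳ m) = [ inj₁ ∘ +ʳ , inj₂ ]′ (replace C m)

  ∑-ground⁻ : ∀ {n} {α : Fin (suc n) → Amp} {t} → Ground (∑ α t) → ∀ i → Ground (α i · t i)
  ∑-ground⁻ {zero}  ground zero    x m = ground x m
  ∑-ground⁻ {suc n} ground zero    x m = ground x (+ˡ m)
  ∑-ground⁻ {suc n} ground (suc i) x m = ∑-ground⁻ (λ y → ground y ∘ +ʳ) i x m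

  ∑-ground : ∀ {n} {α : Fin (suc n) → Amp} {t} → (∀ i → Ground (α i · t i)) → Ground (∑ α t)
  ∑-ground {zero}  ground x m      = ground zero x m
  ∑-ground {suc n} ground x (+ˡ m) = ground zero x m
  ∑-ground {suc n} ground x (+ʳ m) = ∑-ground (ground ∘ suc) x m

  -- An evaluation context passes only below symbols, so a value of this shape would have
  -- constructors all the way down to the hole and also in the hole. Hence values contain no redex
  -- in evaluation position.
  functionCall-nonvalue : ∀ {E f ts} → Evaluation E → ¬ Value (E ⟨ app (fun f) ts ⟩)
  functionCall-nonvalue (app b ts i {E} _ e) (con c vs) =
    functionCall-nonvalue e (subst Value (lookup∘update i ts _) (All-lookup vs i))

-- Amplitudes and coefficients

-- What coefficients require of the complex numbers. `value` extends the interpretation to open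
-- amplitudes by an assignment of numbers to all variables. `value-zero` and `value-one` hold under
-- every assignment, whereas `value-nonzero` needs a ground amplitude: an open one that does not
-- denote zero may still vanish at the given assignment.
record AmplitudeModel (S : Alphabet) : Set₁ where
  open Alphabet S
  open Terms S
  field
    scalars : CommutativeSemiring 0ℓ 0ℓ
  open CommutativeSemiring scalars public
    using () renaming (_≈_ to _≃_; _+_ to _⊞_; _*_ to _⊠_; 0# to 𝟘; 1# to 𝟙)
  field
    value         : (𝒳 → ℕ) → Amp → CommutativeSemiring.Carrier scalars
    value-⊙       : ∀ {ρ} α β → value ρ (α ⊙ β) ≃ value ρ α ⊠ value ρ β
    value-⊕       : ∀ {ρ} α β → value ρ (α ⊕ β) ≃ value ρ α ⊞ value ρ β
    value-zero    : ∀ {ρ α} → α denotes 0ℂ → value ρ α ≃ 𝟘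
    value-one     : ∀ {ρ α} → α denotes 1ℂ → value ρ α ≃ 𝟙
    value-nonzero : ∀ {ρ α} → GroundAmp α → ¬ (α denotes 0ℂ) → ¬ (value ρ α ≃ 𝟘)
    value-subst   : ∀ σ ρ → ∃[ ρ′ ] (∀ {α β} → α [ σ ]≐ᴬ β → value ρ β ≃ value ρ′ α)
    𝟙≄𝟘           : ¬ (𝟙 ≃ 𝟘)

module _ (em : ExcludedMiddle 0ℓ) (S : Alphabet) where

  open Alphabet S
  open Terms S
  open Substitutions S using (⌜⌝-injective)
  private module ℂ′ = CommutativeSemiring ℂ-commutativeSemiring

  valueᴺ : (𝒳 → ℕ) → Nat → ℕ
  valueᴺ ρ (var x) = ρ x
  valueᴺ ρ zero    = 0
  valueᴺ ρ (suc ι) = suc (valueᴺ ρ ι)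

  valueᴬ : (𝒳 → ℕ) → Amp → ℂ
  valueᴬ ρ (amp a ιs) = ⟦ a ⟧ˢ (Vec.map (valueᴺ ρ) ιs)
  valueᴬ ρ (α ⊙ β)    = valueᴬ ρ α *ᶜ valueᴬ ρ β
  valueᴬ ρ (α ⊕ β)    = valueᴬ ρ α +ᶜ valueᴬ ρ β

  ⟦⟧ᴺ≡valueᴺ : ∀ {ρ} ι g → ⟦ ι ⟧ᴺ g ≡ valueᴺ ρ ι
  ⟦⟧ᴺ≡valueᴺ (var x) g = ⊥-elim (g x var)
  ⟦⟧ᴺ≡valueᴺ zero    g = refl
  ⟦⟧ᴺ≡valueᴺ (suc ι) g = cong suc (⟦⟧ᴺ≡valueᴺ ι _)

  ⟦⟧ᴺˢ≡valueᴺ : ∀ {ρ n} (ιs : Vec Nat n) g → ⟦ ιs ⟧ᴺˢ g ≡ Vec.map (valueᴺ ρ) ιs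
  ⟦⟧ᴺˢ≡valueᴺ []       g = refl
  ⟦⟧ᴺˢ≡valueᴺ (ι ∷ ιs) g = cong₂ _∷_ (⟦⟧ᴺ≡valueᴺ ι _) (⟦⟧ᴺˢ≡valueᴺ ιs _)

  -- Stated on sequences: comparing elements of ℂ makes the type checker unfold Cauchy proofs.
  mutual
    re-⟦⟧ᴬ : ∀ {ρ} α g n → seq (re (⟦ α ⟧ᴬ g)) n ≡ seq (re (valueᴬ ρ α)) n
    re-⟦⟧ᴬ (amp a ιs) g n = cong (λ ks → seq (re (⟦ a ⟧ˢ ks)) n) (⟦⟧ᴺˢ≡valueᴺ ιs _)
    re-⟦⟧ᴬ (α ⊙ β)    g n = cong₂ ℚ._+_
      (cong₂ ℚ._*_ (re-⟦⟧ᴬ α _ n) (re-⟦⟧ᴬ β _ n)) (cong ℚ.-_ (cong₂ ℚ._*_ (im-⟦⟧ᴬ α _ n) (im-⟦⟧ᴬ β _ n)))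
    re-⟦⟧ᴬ (α ⊕ β)    g n = cong₂ ℚ._+_ (re-⟦⟧ᴬ α _ n) (re-⟦⟧ᴬ β _ n)

    im-⟦⟧ᴬ : ∀ {ρ} α g n → seq (im (⟦ α ⟧ᴬ g)) n ≡ seq (im (valueᴬ ρ α)) n
    im-⟦⟧ᴬ (amp a ιs) g n = cong (λ ks → seq (im (⟦ a ⟧ˢ ks)) n) (⟦⟧ᴺˢ≡valueᴺ ιs _)
    im-⟦⟧ᴬ (α ⊙ β)    g n = cong₂ ℚ._+_
      (cong₂ ℚ._*_ (re-⟦⟧ᴬ α _ n) (im-⟦⟧ᴬ β _ n)) (cong₂ ℚ._*_ (im-⟦⟧ᴬ α _ n) (re-⟦⟧ᴬ β _ n))
    im-⟦⟧ᴬ (α ⊕ β)    g n = cong₂ ℚ._+_ (im-⟦⟧ᴬ α _ n) (im-⟦⟧ᴬ β _ n)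

  ⟦⟧ᴬ≈valueᴬ : ∀ {ρ} α g → ⟦ α ⟧ᴬ g ≈ valueᴬ ρ α
  ⟦⟧ᴬ≈valueᴬ {ρ} α g = pointwise⇒≈ {⟦ α ⟧ᴬ g} {valueᴬ ρ α} (re-⟦⟧ᴬ α g) (im-⟦⟧ᴬ α g)

  module _ {σ : Substitution} {ρ ρ′ : 𝒳 → ℕ} (agree : ∀ x ι → map σ x ≡ ⌜ ι ⌝ → valueᴺ ρ ι ≡ ρ′ x) where

    valueᴺ-subst : ∀ {ι κ} → ι [ σ ]≐ᴺ κ → valueᴺ ρ κ ≡ valueᴺ ρ′ ι
    valueᴺ-subst (var eq) = agree _ _ eq
    valueᴺ-subst zero     = refl
    valueᴺ-subst (suc p)  = cong suc (valueᴺ-subst p)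

    valuesᴺ-subst : ∀ {n} {ιs κs : Vec Nat n} → Pointwise (λ ι κ → ι [ σ ]≐ᴺ κ) ιs κs →
      Vec.map (valueᴺ ρ) κs ≡ Vec.map (valueᴺ ρ′) ιs
    valuesᴺ-subst []       = refl
    valuesᴺ-subst (p ∷ ps) = cong₂ _∷_ (valueᴺ-subst p) (valuesᴺ-subst ps)

    valueᴬ-subst : ∀ {α β} → α [ σ ]≐ᴬ β → valueᴬ ρ β ≡ valueᴬ ρ′ α
    valueᴬ-subst (amp {a} ps) = cong ⟦ a ⟧ˢ (valuesᴺ-subst ps)
    valueᴬ-subst (_⊙_ {α = α} {α′} {β} {β′} p q) = cong₂ _*ᶜ_
      {x = valueᴬ ρ α′} {y = valueᴬ ρ′ α} {u = valueᴬ ρ β′} {v = valueᴬ ρ′ β} (valueᴬ-subst p) (valueᴬ-subst q)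
    valueᴬ-subst (_⊕_ {α = α} {α′} {β} {β′} p q) = cong₂ _+ᶜ_
      {x = valueᴬ ρ α′} {y = valueᴬ ρ′ α} {u = valueᴬ ρ β′} {v = valueᴬ ρ′ β} (valueᴬ-subst p) (valueᴬ-subst q)

  numeral : ℕ → Nat
  numeral zero    = zero
  numeral (suc n) = suc (numeral n)

  valueᴺ-numeral : ∀ {ρ} n → valueᴺ ρ (numeral n) ≡ n
  valueᴺ-numeral zero    = refl
  valueᴺ-numeral (suc n) = cong suc (valueᴺ-numeral n)

  numeral-ground : ∀ {x} n → ¬ (x ∈ᴺ numeral n)
  numeral-ground (suc n) (suc p) = numeral-ground n p

  numeral-value : ∀ n → Value ⌜ numeral n ⌝
  numeral-value zero    = con zero []
  numeral-value (suc n) = con suc (numeral-value n ∷ [])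

  module _ (ρ : 𝒳 → ℕ) where

    numerals : Substitution
    numerals = record { map = λ x → ⌜ numeral (ρ x) ⌝ ; values = λ x → numeral-value (ρ x) }

    instantiateᴺ : ∀ ι → ∃[ κ ] (ι [ numerals ]≐ᴺ κ × (∀ x → ¬ (x ∈ᴺ κ)))
    instantiateᴺ (var x) = numeral (ρ x) , var refl , λ _ → numeral-ground (ρ x)
    instantiateᴺ zero    = zero , zero , λ _ ()
    instantiateᴺ (suc ι) = let κ , p , g = instantiateᴺ ι in suc κ , suc p , λ { x (suc q) → g x q }

    instantiateᴺˢ : ∀ {n} (ιs : Vec Nat n) →
      Σ[ κs ∈ Vec Nat n ] (Pointwise (λ ι κ → ι [ numerals ]≐ᴺ κ) ιs κs × (∀ x → ¬ Any (x ∈ᴺ_) κs))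
    instantiateᴺˢ []       = [] , [] , λ _ ()
    instantiateᴺˢ (ι ∷ ιs) =
      let κ , p , g    = instantiateᴺ ι
          κs , ps , gs = instantiateᴺˢ ιs
      in κ ∷ κs , p ∷ ps , λ { x (here q) → g x q ; x (there q) → gs x q }

    instantiateᴬ : ∀ α → ∃[ β ] (α [ numerals ]≐ᴬ β × GroundAmp β)
    instantiateᴬ (amp a ιs) =
      let κs , ps , g = instantiateᴺˢ ιs in amp a κs , amp ps , λ { x (amp q) → g x q }
    instantiateᴬ (α ⊙ β) =
      let α′ , p , g = instantiateᴬ α
          β′ , q , h = instantiateᴬ β
      in α′ ⊙ β′ , p ⊙ q , λ { x (⊙ˡ r) → g x r ; x (⊙ʳ r) → h x r }
    instantiateᴬ (α ⊕ β) =
      let α′ , p , g = instantiateᴬ α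
          β′ , q , h = instantiateᴬ β
      in α′ ⊕ β′ , p ⊕ q , λ { x (⊕ˡ r) → g x r ; x (⊕ʳ r) → h x r }

    -- `denotes` quantifies over all substitutions, among them the one by the numerals of `ρ`; the
    -- instance it produces has the value of `α` at `ρ`.
    denotes⇒valueᴬ : ∀ {α z} → α denotes z → valueᴬ ρ α ≈ z
    denotes⇒valueᴬ {α} {z} d =
      let β , p , g = instantiateᴬ α
      in subst (_≈ z) (valueᴬ-subst agree p)
           (ℂ′.trans {valueᴬ ρ β} {⟦ β ⟧ᴬ g} {z}
             (ℂ′.sym {⟦ β ⟧ᴬ g} {valueᴬ ρ β} (⟦⟧ᴬ≈valueᴬ β g)) (d numerals β p g))
      where
      agree : ∀ x ι → ⌜ numeral (ρ x) ⌝ ≡ ⌜ ι ⌝ → valueᴺ ρ ι ≡ ρ x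
      agree x ι eq rewrite sym (⌜⌝-injective (numeral (ρ x)) ι eq) = valueᴺ-numeral (ρ x)

  assignment : Substitution → (𝒳 → ℕ) → 𝒳 → ℕ
  assignment σ ρ x with em {∃[ ι ] map σ x ≡ ⌜ ι ⌝}
  ... | yes (ι , _) = valueᴺ ρ ι
  -- If `map σ x` is not a natural, no amplitude containing `x` has an instance under `σ`, so the
  -- default is never compared with anything.
  ... | no _        = 0

  assignment-agrees : ∀ σ ρ x ι → map σ x ≡ ⌜ ι ⌝ → valueᴺ ρ ι ≡ assignment σ ρ x
  assignment-agrees σ ρ x ι eq with em {∃[ ι ] map σ x ≡ ⌜ ι ⌝}
  ... | yes (κ , eq′) = cong (valueᴺ ρ) (⌜⌝-injective ι κ (trans (sym eq) eq′))
  ... | no none       = contradiction (ι , eq) none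

  ground-substᴺ : ∀ {σ ι κ} → (∀ x → ¬ (x ∈ᴺ ι)) → ι [ σ ]≐ᴺ κ → ι ≡ κ
  ground-substᴺ g (var {x} _) = ⊥-elim (g x var)
  ground-substᴺ g zero        = refl
  ground-substᴺ g (suc p)     = cong suc (ground-substᴺ (λ x q → g x (suc q)) p)

  ground-substᴺˢ : ∀ {σ n} {ιs κs : Vec Nat n} → (∀ x → ¬ Any (x ∈ᴺ_) ιs) →
    Pointwise (λ ι κ → ι [ σ ]≐ᴺ κ) ιs κs → ιs ≡ κs
  ground-substᴺˢ g []       = refl
  ground-substᴺˢ g (p ∷ ps) =
    cong₂ _∷_ (ground-substᴺ (λ x q → g x (here q)) p) (ground-substᴺˢ (λ x q → g x (there q)) ps)

  ground-substᴬ : ∀ {σ α β} → GroundAmp α → α [ σ ]≐ᴬ β → α ≡ β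
  ground-substᴬ g (amp ps) = cong (amp _) (ground-substᴺˢ (λ x q → g x (amp q)) ps)
  ground-substᴬ g (p ⊙ q)  =
    cong₂ _⊙_ (ground-substᴬ (λ x r → g x (⊙ˡ r)) p) (ground-substᴬ (λ x r → g x (⊙ʳ r)) q)
  ground-substᴬ g (p ⊕ q)  =
    cong₂ _⊕_ (ground-substᴬ (λ x r → g x (⊕ˡ r)) p) (ground-substᴬ (λ x r → g x (⊕ʳ r)) q)

  ℂ-model : AmplitudeModel S
  ℂ-model = record
    { scalars       = ℂ-commutativeSemiring
    ; value         = valueᴬ
    ; value-⊙       = λ {ρ} α β → ℂ′.refl {valueᴬ ρ (α ⊙ β)}
    ; value-⊕       = λ {ρ} α β → ℂ′.refl {valueᴬ ρ (α ⊕ β)}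
    ; value-zero    = λ {ρ} {α} → denotes⇒valueᴬ ρ {α} {0ℂ}
    ; value-one     = λ {ρ} {α} → denotes⇒valueᴬ ρ {α} {1ℂ}
    -- A ground amplitude is its own only instance, so its vanishing at the single assignment `ρ`
    -- would already make it denote zero.
    ; value-nonzero = λ {ρ} {α} ground nonzero α≈0 → nonzero λ σ β p g →
        ℂ′.trans {⟦ β ⟧ᴬ g} {valueᴬ ρ β} {0ℂ} (⟦⟧ᴬ≈valueᴬ β g)
          (subst (λ γ → valueᴬ ρ γ ≈ 0ℂ) (ground-substᴬ ground p) α≈0)
    ; value-subst   = λ σ ρ → assignment σ ρ , λ {α} {β} p →
        ℂ′.reflexive (valueᴬ-subst (assignment-agrees σ ρ) p)
    ; 𝟙≄𝟘           = 1ℂ≉0ℂ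
    }

-- Coefficients of classical terms and their invariance

module Coefficients (em : ExcludedMiddle 0ℓ) {S : Alphabet} (M : AmplitudeModel S) where

  open Alphabet S
  open Terms S
  open AmplitudeModel M public
  module K = CommutativeSemiring scalars
  open CommutativeSemigroupProperties K.*-commutativeSemigroup using (x∙yz≈y∙xz)

  δ : Term → Term → K.Carrier
  δ s t with em {s ≡ t}
  ... | yes _ = 𝟙
  ... | no _  = 𝟘

  module _ (ρ : 𝒳 → ℕ) (η : 𝒳 → Term) where

    mutual
      -- A variable counts as the number `ρ x` inside amplitudes and as the term `η x`, compared as
      -- a whole, elsewhere. A symbol multiplies the coefficients of its arguments because it is
      -- multilinear up to `≋`. The second argument is meant to be classical.
      coef : Term → Term → K.Carrier
      coef (var x)    q           = δ (η x) q
      coef (app b ts) (var _)     = 𝟘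
      coef (app b ts) (app b′ qs) = coef-app (em {b ≡ b′}) ts qs
      coef (app b ts) (_ · _)     = 𝟘
      coef (app b ts) (_ + _)     = 𝟘
      coef (α · t)    q           = value ρ α ⊠ coef t q
      coef (s + t)    q           = coef s q ⊞ coef t q

      coef-app : ∀ {b b′} → Dec (b ≡ b′) → Vec Term (arity b) → Vec Term (arity b′) → K.Carrier
      coef-app (yes refl) ts qs = coefs ts qs
      coef-app (no _)     ts qs = 𝟘

      coefs : ∀ {n} → Vec Term n → Vec Term n → K.Carrier
      coefs []       []       = 𝟙
      coefs (t ∷ ts) (q ∷ qs) = coef t q ⊠ coefs ts qs

  module _ (η : 𝒳 → Term) where

    mutual
      instantiate : Term → Term
      instantiate (var x)    = η x
      instantiate (app b ts) = app b (instantiates ts)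
      instantiate (α · t)    = α · instantiate t
      instantiate (s + t)    = instantiate s + instantiate t

      instantiates : ∀ {n} → Vec Term n → Vec Term n
      instantiates []       = []
      instantiates (t ∷ ts) = instantiate t ∷ instantiates ts

  module _ {ρ : 𝒳 → ℕ} {η : 𝒳 → Term} where

    private
      ⟪_⟫ = instantiate η
      ⟪_⟫ˢ : ∀ {n} → Vec Term n → Vec Term n
      ⟪_⟫ˢ = instantiates η
      c = coef ρ η
      cs : ∀ {n} → Vec Term n → Vec Term n → K.Carrier
      cs = coefs ρ η

    coef-app-same : ∀ b ts qs → c (app b ts) (app b qs) ≡ cs ts qs
    coef-app-same b ts qs with em {b ≡ b}
    ... | yes refl = refl
    ... | no b≢b   = contradiction refl b≢b

    -- Whether the heads match depends on `b` and `q` alone, so one case distinction serves all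
    -- argument vectors, in particular both sides of an equation of `≋`.
    coef-app-cases : ∀ b q → (∀ ts → c (app b ts) q ≡ 𝟘) ⊎
      (∃[ qs ] (q ≡ app b qs × ∀ ts → c (app b ts) q ≡ cs ts qs))
    coef-app-cases b (var x)     = inj₁ λ _ → refl
    coef-app-cases b (α · q)     = inj₁ λ _ → refl
    coef-app-cases b (q + r)     = inj₁ λ _ → refl
    coef-app-cases b (app b′ qs) with em {b ≡ b′}
    ... | yes refl = inj₂ (qs , refl , λ _ → refl)
    ... | no _     = inj₁ λ _ → refl

    coefs-cong : ∀ {n} {s t} (ts : Vec Term n) i qs → (∀ q → c s q K.≈ c t q) →
      cs (ts [ i ]≔ s) qs K.≈ cs (ts [ i ]≔ t) qs
    coefs-cong (_ ∷ ts) zero    (q ∷ qs) eq = K.*-congʳ (eq q)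
    coefs-cong (_ ∷ ts) (suc i) (q ∷ qs) eq = K.*-congˡ (coefs-cong ts i qs eq)

    coefs-· : ∀ {n} {α t} (ts : Vec Term n) i qs →
      cs (ts [ i ]≔ (α · t)) qs K.≈ value ρ α ⊠ cs (ts [ i ]≔ t) qs
    coefs-· (_ ∷ ts) zero    (q ∷ qs) = K.*-assoc _ _ _
    coefs-· (_ ∷ ts) (suc i) (q ∷ qs) = K.trans (K.*-congˡ (coefs-· ts i qs)) (x∙yz≈y∙xz _ _ _)

    coefs-+ : ∀ {n} {s t} (ts : Vec Term n) i qs →
      cs (ts [ i ]≔ (s + t)) qs K.≈ cs (ts [ i ]≔ s) qs ⊞ cs (ts [ i ]≔ t) qs
    coefs-+ (_ ∷ ts) zero    (q ∷ qs) = K.distribʳ _ _ _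
    coefs-+ (_ ∷ ts) (suc i) (q ∷ qs) = K.trans (K.*-congˡ (coefs-+ ts i qs)) (K.distribˡ _ _ _)

    coef-context : ∀ C {s t} → (∀ q → c s q K.≈ c t q) → ∀ q → c (C ⟨ s ⟩) q K.≈ c (C ⟨ t ⟩) q
    coef-context ◇            eq q = eq q
    coef-context (app b ts i C) eq q with coef-app-cases b q
    ... | inj₁ vanishes          = K.reflexive (trans (vanishes _) (sym (vanishes _)))
    ... | inj₂ (qs , _ , is) =
      K.trans (K.reflexive (is _))
        (K.trans (coefs-cong ts i qs (coef-context C eq)) (K.reflexive (sym (is _))))
    coef-context (α · C)  eq q = K.*-congˡ (coef-context C eq q)
    coef-context (+ˡ C t) eq q = K.+-congʳ (coef-context C eq q)
    coef-context (+ʳ t C) eq q = K.+-congˡ (coef-context C eq q)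

    -- Each generating equation becomes a semiring law, those for symbols by multilinearity of the
    -- product over the arguments. The result holds for every reading `ρ`, `η`, so it also applies
    -- to open right-hand sides.
    coef-≋ : ∀ {s t} → s ≋ t → ∀ q → c s q K.≈ c t q
    coef-≋ ≋-refl          q = K.refl
    coef-≋ (≋-sym p)       q = K.sym (coef-≋ p q)
    coef-≋ (≋-trans p p′)  q = K.trans (coef-≋ p q) (coef-≋ p′ q)
    coef-≋ (≋-cong C p)    q = coef-context C (coef-≋ p) q
    coef-≋ +-comm          q = K.+-comm _ _
    coef-≋ +-assoc         q = K.sym (K.+-assoc _ _ _)
    coef-≋ (zero-· α≈0)    q =
      K.trans (K.+-congˡ (K.trans (K.*-congʳ (value-zero α≈0)) (K.zeroˡ _))) (K.+-identityʳ _)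
    coef-≋ (one-· α≈1)     q = K.trans (K.*-congʳ (value-one α≈1)) (K.*-identityˡ _)
    coef-≋ (·-· {α} {β})   q = K.trans (K.sym (K.*-assoc _ _ _)) (K.*-congʳ (K.sym (value-⊙ α β)))
    coef-≋ ·-+             q = K.distribˡ _ _ _
    coef-≋ (⊕-· {α} {β})   q = K.trans (K.sym (K.distribʳ _ _ _)) (K.*-congʳ (K.sym (value-⊕ α β)))
    coef-≋ (app-· {b} {ts} {i}) q with coef-app-cases b q
    ... | inj₁ vanishes          =
      K.trans (K.reflexive (vanishes _)) (K.sym (K.trans (K.*-congˡ (K.reflexive (vanishes _))) (K.zeroʳ _)))
    ... | inj₂ (qs , _ , is) =
      K.trans (K.reflexive (is _)) (K.trans (coefs-· ts i qs) (K.*-congˡ (K.reflexive (sym (is _)))))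
    coef-≋ (app-+ {b} {ts} {i}) q with coef-app-cases b q
    ... | inj₁ vanishes          = K.trans (K.reflexive (vanishes _))
      (K.sym (K.trans (K.+-cong (K.reflexive (vanishes _)) (K.reflexive (vanishes _))) (K.+-identityʳ _)))
    ... | inj₂ (qs , _ , is) = K.trans (K.reflexive (is _))
      (K.trans (coefs-+ ts i qs) (K.+-cong (K.reflexive (sym (is _))) (K.reflexive (sym (is _)))))

    δ-same : ∀ {s t} → s ≡ t → δ s t ≡ 𝟙
    δ-same {s} {t} s≡t with em {s ≡ t}
    ... | yes _   = refl
    ... | no s≢t  = contradiction s≡t s≢t

    δ-different : ∀ {s t} → s ≢ t → δ s t ≡ 𝟘
    δ-different {s} {t} s≢t with em {s ≡ t}
    ... | yes s≡t = contradiction s≡t s≢t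
    ... | no _    = refl

    mutual
      coef-instance : ∀ {t} → Classical t → c t ⟪ t ⟫ K.≈ 𝟙
      coef-instance (var x)             = K.reflexive (δ-same refl)
      coef-instance (app b {ts} ts-classical) =
        K.trans (K.reflexive (coef-app-same b ts ⟪ ts ⟫ˢ)) (coefs-instance ts-classical)

      coefs-instance : ∀ {n} {ts : Vec Term n} → All Classical ts → cs ts ⟪ ts ⟫ˢ K.≈ 𝟙
      coefs-instance []       = K.refl
      coefs-instance (p ∷ ps) = K.trans (K.*-cong (coef-instance p) (coefs-instance ps)) (K.*-identityˡ _)

    mutual
      coef-noninstance : ∀ {t q} → Classical t → ⟪ t ⟫ ≢ q → c t q K.≈ 𝟘
      coef-noninstance (var x) t≢q = K.reflexive (δ-different t≢q)
      coef-noninstance {q = q} (app b ps) t≢q with coef-app-cases b q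
      ... | inj₁ vanishes             = K.reflexive (vanishes _)
      ... | inj₂ (qs , refl , is) = K.trans (K.reflexive (is _)) (coefs-noninstance ps (t≢q ∘ cong (app b)))

      coefs-noninstance : ∀ {n} {ts qs : Vec Term n} → All Classical ts → ⟪ ts ⟫ˢ ≢ qs → cs ts qs K.≈ 𝟘
      coefs-noninstance {qs = []} [] ts≢qs = contradiction refl ts≢qs
      coefs-noninstance {ts = t ∷ ts} {q ∷ qs} (p ∷ ps) ts≢qs with em {⟪ t ⟫ ≡ q}
      ... | yes refl = K.trans (K.*-congˡ (coefs-noninstance ps (ts≢qs ∘ cong (⟪ t ⟫ ∷_)))) (K.zeroʳ _)
      ... | no t≢q   = K.trans (K.*-congʳ (coef-noninstance p t≢q)) (K.zeroˡ _)

    coef-classical : ∀ {t q} → Classical t → ¬ (c t q ≃ 𝟘) → ⟪ t ⟫ ≡ q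
    coef-classical {t} {q} p nonzero with em {⟪ t ⟫ ≡ q}
    ... | yes eq = eq
    ... | no neq = contradiction (coef-noninstance p neq) nonzero

    coefs-classical : ∀ {n} {ts qs : Vec Term n} → All Classical ts → ¬ (cs ts qs ≃ 𝟘) → ⟪ ts ⟫ˢ ≡ qs
    coefs-classical {ts = ts} {qs} ps nonzero with em {⟪ ts ⟫ˢ ≡ qs}
    ... | yes eq = eq
    ... | no neq = contradiction (coefs-noninstance ps neq) nonzero

    coef-∑-zero : ∀ {n} {α : Fin (suc n) → Amp} {t q} → (∀ i → c (t i) q ≃ 𝟘) → c (∑ α t) q ≃ 𝟘
    coef-∑-zero {zero}  zeros = K.trans (K.*-congˡ (zeros zero)) (K.zeroʳ _)
    coef-∑-zero {suc n} zeros =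
      K.trans (K.+-cong (K.trans (K.*-congˡ (zeros zero)) (K.zeroʳ _)) (coef-∑-zero (zeros ∘ suc)))
        (K.+-identityʳ _)

    coef-∑-nonzero : ∀ {n} {α : Fin (suc n) → Amp} {t q} → ¬ (c (∑ α t) q ≃ 𝟘) → ∃[ i ] ¬ (c (t i) q ≃ 𝟘)
    coef-∑-nonzero {t = t} {q} nonzero with em {∃[ i ] ¬ (c (t i) q ≃ 𝟘)}
    ... | yes found = found
    ... | no none   = contradiction (coef-∑-zero zeros) nonzero
      where
      zeros : ∀ i → c (t i) q ≃ 𝟘
      zeros i with em {c (t i) q ≃ 𝟘}
      ... | yes eq = eq
      ... | no neq = contradiction (i , neq) none

    coef-∑-single : ∀ {n} {α : Fin (suc n) → Amp} {t q} i → (∀ j → j ≢ i → c (t j) q ≃ 𝟘) →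
      c (∑ α t) q ≃ value ρ (α i) ⊠ c (t i) q
    coef-∑-single {zero}  zero    zeros = K.refl
    coef-∑-single {suc n} zero    zeros =
      K.trans (K.+-congˡ (coef-∑-zero λ j → zeros (suc j) λ ())) (K.+-identityʳ _)
    coef-∑-single {suc n} (suc i) zeros = K.trans
      (K.+-cong (K.trans (K.*-congˡ (zeros zero λ ())) (K.zeroʳ _))
        (coef-∑-single i λ j j≢i → zeros (suc j) (j≢i ∘ Fin.suc-injective)))
      (K.+-identityˡ _)

  mutual
    instantiate-var : ∀ {t} → Classical t → instantiate var t ≡ t
    instantiate-var (var x)    = refl
    instantiate-var (app b ps) = cong (app b) (instantiates-var ps)

    instantiates-var : ∀ {n} {ts : Vec Term n} → All Classical ts → instantiates var ts ≡ ts
    instantiates-var []       = refl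
    instantiates-var (p ∷ ps) = cong₂ _∷_ (instantiate-var p) (instantiates-var ps)

  mutual
    instantiate-≐ : ∀ {t} σ → Classical t → t [ σ ]≐ instantiate (map σ) t
    instantiate-≐ σ (var x)    = var
    instantiate-≐ σ (app b ps) = app (instantiates-≐ σ ps)

    instantiates-≐ : ∀ {n} {ts : Vec Term n} σ → All Classical ts →
      Pointwise (λ t u → t [ σ ]≐ u) ts (instantiates (map σ) ts)
    instantiates-≐ σ []       = []
    instantiates-≐ σ (p ∷ ps) = instantiate-≐ σ p ∷ instantiates-≐ σ ps

  module _ {σ : Substitution} {ρ ρ′ : 𝒳 → ℕ} (σ-classical : ∀ x → Classical (map σ x))
           (values-agree : ∀ {α β} → α [ σ ]≐ᴬ β → value ρ β ≃ value ρ′ α) where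

    mutual
      -- The substitution lemma: instantiating by `σ` is absorbed into the reading of the variables.
      -- Classical images are essential at variables, since `δ` treats `map σ x` as one indivisible
      -- term, which would be wrong for a superposition.
      coef-subst : ∀ {r u} → r [ σ ]≐ u → ∀ q → coef ρ var u q K.≈ coef ρ′ (map σ) r q
      coef-subst (var {x}) q with em {map σ x ≡ q}
      ... | yes refl = K.trans (K.reflexive (cong (coef ρ var (map σ x)) (sym (instantiate-var (σ-classical x)))))
        (coef-instance (σ-classical x))
      ... | no neq = coef-noninstance (σ-classical x) (neq ∘ trans (sym (instantiate-var (σ-classical x))))
      coef-subst (app {b} ps) (var x)  = K.refl
      coef-subst (app {b} ps) (α · q)  = K.refl
      coef-subst (app {b} ps) (q + r)  = K.refl
      coef-subst (app {b} ps) (app b′ qs) with em {b ≡ b′}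
      ... | yes refl = coefs-subst ps qs
      ... | no _     = K.refl
      coef-subst (p · p′) q = K.*-cong (values-agree p) (coef-subst p′ q)
      coef-subst (p + p′) q = K.+-cong (coef-subst p q) (coef-subst p′ q)

      coefs-subst : ∀ {n} {ts us : Vec Term n} → Pointwise (λ t u → t [ σ ]≐ u) ts us → ∀ qs →
        coefs ρ var us qs K.≈ coefs ρ′ (map σ) ts qs
      coefs-subst []       []       = K.refl
      coefs-subst (p ∷ ps) (q ∷ qs) = K.*-cong (coef-subst p q) (coefs-subst ps qs)

-- Existence of canonical forms

module CanonicalForms (em : ExcludedMiddle 0ℓ) (S : Alphabet) (unitDenotable : Terms.UnitDenotable S) where

  open Alphabet S
  open Terms S

  -- Moving sums and amplitudes out of symbols

  data Flat : Term → Set where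
    [_] : ∀ {α t} → Classical t → Flat (α · t)
    _∷_ : ∀ {α t u} → Classical t → Flat u → Flat (α · t + u)

  Flattens : Term → Set
  Flattens t = ∃[ u ] (t ≋ u × Flat u)

  flattens-≋ : ∀ {s t} → s ≋ t → Flattens t → Flattens s
  flattens-≋ s≋t (u , t≋u , flat) = u , ≋-trans s≋t t≋u , flat

  -- In a flat sum every summand carries an amplitude, so a bare term has to be given one that
  -- denotes 1.
  flattens-classical : ∀ {t} → Classical t → Flattens t
  flattens-classical {t} p = proj₁ unitDenotable · t , ≋-sym (one-· (proj₂ unitDenotable)) , [ p ]

  flat-· : ∀ {u} α → Flat u → Flattens (α · u)
  flat-· α [ p ]      = _ , ·-· , [ p ]
  flat-· α (p ∷ flat) =
    let v , eq , flat′ = flat-· α flat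
    in _ , ≋-trans ·-+ (≋-trans (≋-cong (+ˡ ◇ _) ·-·) (≋-cong (+ʳ _ ◇) eq)) , p ∷ flat′

  flattens-· : ∀ {t} α → Flattens t → Flattens (α · t)
  flattens-· α (u , t≋u , flat) = flattens-≋ (≋-cong (α · ◇) t≋u) (flat-· α flat)

  flat-+ : ∀ {u v} → Flat u → Flat v → Flattens (u + v)
  flat-+ [ p ]      flat′ = _ , ≋-refl , p ∷ flat′
  flat-+ (p ∷ flat) flat′ =
    let w , eq , flat″ = flat-+ flat flat′
    in _ , ≋-trans (≋-sym +-assoc) (≋-cong (+ʳ _ ◇) eq) , p ∷ flat″

  flattens-+ : ∀ {s t} → Flattens s → Flattens t → Flattens (s + t)
  flattens-+ (u , s≋u , flat) (v , t≋v , flat′) =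
    flattens-≋ (≋-trans (≋-cong (+ˡ ◇ _) s≋u) (≋-cong (+ʳ _ ◇) t≋v)) (flat-+ flat flat′)

  -- Abstracts from `app b` so that arguments can be treated one at a time: with its first argument
  -- fixed, a multilinear `F` is again multilinear, while a symbol applied to only some of its
  -- arguments is not a term.
  record Multilinear {n} (F : Vec Term n → Term) : Set where
    field
      F-cong : ∀ ts i {s t} → s ≋ t → F (ts [ i ]≔ s) ≋ F (ts [ i ]≔ t)
      F-·    : ∀ ts i {α t} → F (ts [ i ]≔ (α · t)) ≋ α · F (ts [ i ]≔ t)
      F-+    : ∀ ts i {s t} → F (ts [ i ]≔ (s + t)) ≋ F (ts [ i ]≔ s) + F (ts [ i ]≔ t)
  open Multilinear

  flattens-multilinear : ∀ {n} {F : Vec Term n → Term} → Multilinear F →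
    (∀ {ts} → All Classical ts → Flattens (F ts)) → ∀ {ts} → All Flattens ts → Flattens (F ts)
  flattens-multilinear {zero}  linear classical [] = classical []
  flattens-multilinear {suc n} {F} linear classical {t ∷ ts} ((u , t≋u , flat) ∷ fs) =
    flattens-≋ (F-cong linear (t ∷ ts) zero t≋u) (head flat)
    where
    tail : ∀ {s} → Classical s → Flattens (F (s ∷ ts))
    tail {s} p = flattens-multilinear
      (record
        { F-cong = λ ts i → F-cong linear (s ∷ ts) (suc i)
        ; F-·    = λ ts i → F-· linear (s ∷ ts) (suc i)
        ; F-+    = λ ts i → F-+ linear (s ∷ ts) (suc i)
        })
      (λ ps → classical (p ∷ ps)) fs

    head : ∀ {u} → Flat u → Flattens (F (u ∷ ts))
    head [ p ]      = flattens-≋ (F-· linear (t ∷ ts) zero) (flattens-· _ (tail p))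
    head (p ∷ flat) = flattens-≋ (F-+ linear (t ∷ ts) zero)
      (flattens-+ (flattens-≋ (F-· linear (t ∷ ts) zero) (flattens-· _ (tail p))) (head flat))

  mutual
    flatten : ∀ t → Flattens t
    flatten (var x)    = flattens-classical (var x)
    flatten (app b ts) = flattens-multilinear
      (record
        { F-cong = λ ts i → ≋-cong (app b ts i ◇)
        ; F-·    = λ ts i → app-· {b} {ts} {i}
        ; F-+    = λ ts i → app-+ {b} {ts} {i}
        })
      (λ ps → flattens-classical (app b ps)) (flattens ts)
    flatten (α · t)    = flattens-· α (flatten t)
    flatten (s + t)    = flattens-+ (flatten s) (flatten t)

    flattens : ∀ {n} (ts : Vec Term n) → All Flattens ts
    flattens []       = []
    flattens (t ∷ ts) = flatten t ∷ flattens ts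

  -- Collecting equal summands

  data CanonicalSum : List Term → Term → Set where
    single : ∀ {α t} → Classical t → ¬ (α denotes 0ℂ) → CanonicalSum (t ∷ []) (α · t)
    cons   : ∀ {α t ts u} → Classical t → ¬ (α denotes 0ℂ) → t ∉ ts → CanonicalSum ts u →
      CanonicalSum (t ∷ ts) (α · t + u)

  -- There is no empty sum among the terms, so a term in which everything cancels has no canonical
  -- form to be rewritten to; it is kept as a multiple by an amplitude denoting zero.
  Vanishes : Term → Set
  Vanishes t = ∃[ α ] ∃[ u ] (α denotes 0ℂ × t ≋ α · u)

  +-swap : ∀ {s t u} → s + (t + u) ≋ t + (s + u)
  +-swap = ≋-trans +-assoc (≋-trans (≋-cong (+ˡ ◇ _) +-comm) (≋-sym +-assoc))

  -- Walks along the sum until `t` is found or the end is reached. The inclusion of the new list in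
  -- `t ∷ ts` keeps the summands passed on the way distinct from the rest.
  insert : ∀ {α t ts u} → Classical t → CanonicalSum ts u →
    Vanishes (α · t + u) ⊎
    (∃[ us ] ∃[ v ] (CanonicalSum us v × α · t + u ≋ v × (∀ {s} → s ∈ us → s ∈ t ∷ ts)))
  insert {α} {t} p (single {β} {s} q β≉0) with em {t ≡ s}
  ... | yes refl with em {(α ⊕ β) denotes 0ℂ}
  ...   | yes α⊕β≈0 = inj₁ (α ⊕ β , t , α⊕β≈0 , ⊕-·)
  ...   | no α⊕β≉0  = inj₂ (_ , _ , single p α⊕β≉0 , ⊕-· , there)
  insert {α} {t} p (single {β} {s} q β≉0) | no t≢s with em {α denotes 0ℂ}
  ...   | yes α≈0 = inj₂ (_ , _ , single q β≉0 , ≋-trans +-comm (zero-· α≈0) , there)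
  ...   | no α≉0  = inj₂ (_ , _ , cons p α≉0 (λ { (here t≡s) → t≢s t≡s }) (single q β≉0) , ≋-refl , λ m → m)
  insert {α} {t} p (cons {β} {s} q β≉0 s∉ts sum) with em {t ≡ s}
  ... | yes refl with em {(α ⊕ β) denotes 0ℂ}
  ...   | yes α⊕β≈0 = inj₂ (_ , _ , sum ,
      ≋-trans +-assoc (≋-trans (≋-cong (+ˡ ◇ _) ⊕-·) (≋-trans +-comm (zero-· α⊕β≈0))) , λ m → there (there m))
  ...   | no α⊕β≉0  = inj₂ (_ , _ , cons p α⊕β≉0 s∉ts sum ,
      ≋-trans +-assoc (≋-cong (+ˡ ◇ _) ⊕-·) , there)
  insert {α} {t} p (cons {β} {s} {ts} {u} q β≉0 s∉ts sum) | no t≢s with insert {α} p sum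
  -- Everything behind `β · s` cancels with `α · t`, and the summand `β · s` is there to absorb the
  -- zero.
  ...   | inj₁ (γ , v , γ≈0 , eq) = inj₂ (_ , _ , single q β≉0 ,
      ≋-trans +-swap (≋-trans (≋-cong (+ʳ _ ◇) eq) (zero-· γ≈0)) , λ { (here s≡s′) → there (here s≡s′) })
  ...   | inj₂ (us , v , sum′ , eq , us⊆) = inj₂ (_ , _ ,
      cons q β≉0 (s∉t∷ts ∘ us⊆) sum′ ,
      ≋-trans +-swap (≋-cong (+ʳ _ ◇) eq) , weaken)
    where
    s∉t∷ts : ¬ (s ∈ t ∷ ts)
    s∉t∷ts (here s≡t)   = t≢s (sym s≡t)
    s∉t∷ts (there s∈ts) = s∉ts s∈ts
    weaken : ∀ {s′} → s′ ∈ s ∷ us → s′ ∈ t ∷ s ∷ ts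
    weaken (here s′≡s)   = there (here s′≡s)
    weaken (there s′∈us) with us⊆ s′∈us
    ... | here s′≡t   = here s′≡t
    ... | there s′∈ts = there (there s′∈ts)

  merge : ∀ {u} → Flat u → Vanishes u ⊎ (∃[ ts ] ∃[ v ] (CanonicalSum ts v × u ≋ v))
  merge ([_] {α} {t} p) with em {α denotes 0ℂ}
  ... | yes α≈0 = inj₁ (α , t , α≈0 , ≋-refl)
  ... | no α≉0  = inj₂ (_ , _ , single p α≉0 , ≋-refl)
  merge (_∷_ {α} {t} p flat) with merge flat
  ... | inj₁ (β , s , β≈0 , eq) with em {α denotes 0ℂ}
  ...   | yes α≈0 = inj₁ (α , t , α≈0 , ≋-trans (≋-cong (+ʳ _ ◇) eq) (zero-· β≈0))
  ...   | no α≉0  = inj₂ (_ , _ , single p α≉0 , ≋-trans (≋-cong (+ʳ _ ◇) eq) (zero-· β≈0))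
  merge (_∷_ {α} {t} p flat) | inj₂ (ts , v , sum , eq) with insert {α} p sum
  ...   | inj₁ (β , s , β≈0 , eq′)     = inj₁ (β , s , β≈0 , ≋-trans (≋-cong (+ʳ _ ◇) eq) eq′)
  ...   | inj₂ (us , w , sum′ , eq′ , _) = inj₂ (us , w , sum′ , ≋-trans (≋-cong (+ʳ _ ◇) eq) eq′)

  HasCanonicalForm : Term → Set
  HasCanonicalForm r =
    ∃[ n ] Σ[ α ∈ (Fin (suc n) → Amp) ] Σ[ t ∈ (Fin (suc n) → Term) ] ((r ≋ ∑ α t) × Canonical α t)

  canonicalSum⇒∑ : ∀ {ts u} → CanonicalSum ts u →
    ∃[ n ] Σ[ α ∈ (Fin (suc n) → Amp) ] Σ[ t ∈ (Fin (suc n) → Term) ]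
      ((u ≋ ∑ α t) × Canonical α t × (∀ i → t i ∈ ts))
  canonicalSum⇒∑ (single {α} {t} p α≉0) = 0 , (λ _ → α) , (λ _ → t) , ≋-refl ,
    record { classical = λ _ → p ; distinct = λ { {zero} {zero} _ → refl } ; nonzero = λ _ → α≉0 } ,
    λ _ → here refl
  canonicalSum⇒∑ (cons {α} {t} {ts} p α≉0 t∉ts sum) with canonicalSum⇒∑ sum
  ... | n , β , s , eq , canonical , s∈ts =
    suc n , α Vector.∷ β , t Vector.∷ s , ≋-cong (+ʳ _ ◇) eq ,
    record
      { classical = λ { zero → p ; (suc i) → classical i }
      ; distinct  = distinct′
      ; nonzero   = λ { zero → α≉0 ; (suc i) → nonzero i }
      } ,
    λ { zero → here refl ; (suc i) → there (s∈ts i) }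
    where
    open Canonical canonical
    distinct′ : Injective _≡_ _≡_ (t Vector.∷ s)
    distinct′ {zero}  {zero}  _  = refl
    distinct′ {zero}  {suc j} eq = contradiction (subst (_∈ ts) (sym eq) (s∈ts j)) t∉ts
    distinct′ {suc i} {zero}  eq = contradiction (subst (_∈ ts) eq (s∈ts i)) t∉ts
    distinct′ {suc i} {suc j} eq = cong suc (distinct eq)

  canonicalForm : ∀ r → Vanishes r ⊎ HasCanonicalForm r
  canonicalForm r with flatten r
  ... | u , r≋u , flat with merge flat
  ...   | inj₁ (α , s , α≈0 , eq) = inj₁ (α , s , α≈0 , ≋-trans r≋u eq)
  ...   | inj₂ (ts , v , sum , eq) with canonicalSum⇒∑ sum
  ...     | n , α , t , eq′ , canonical , _ = inj₂ (n , α , t , ≋-trans r≋u (≋-trans eq eq′) , canonical)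

-- Uniqueness of classical reducts

module Determinism (R : STRS) where

  open STRS R
  open Reduction R
  open Substitutions alphabet

  record Contracts (u v : Term) : Set where
    constructor contraction
    field
      {l r} : Term
      {σ}   : Substitution
      rule  : ℛ l r
      l≐    : l [ σ ]≐ u
      r≐    : r [ σ ]≐ v

  -- Two redexes at the same place overlap at the root, so their rules coincide. Matching then fixes
  -- the substitution on the variables of the left-hand side, which include those of the right-hand
  -- side.
  contracts-unique : ∀ {u v v′} → Contracts u v → Contracts u v′ → v ≡ v′
  contracts-unique (contraction rule l≐ r≐) (contraction rule′ l′≐ r′≐) with rules rule
  ... | record { l≡ = refl ; patterns = ps ; variables = vars }
    with nonOverlapping rule rule′ ◇ refl app l≐ l′≐
  ... | _ , refl , refl = ≐-unique (≐-agree agree r≐) r′≐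
    where agree = λ x m → matching-unique (app _ (patterns⇒classical ps)) l≐ l′≐ (vars x m)

  contracts-functionCall : ∀ {u v} → Contracts u v → ∃[ f ] ∃[ vs ] (u ≡ app (fun f) vs × All Value vs)
  contracts-functionCall (contraction rule l≐ r≐) with rules rule
  ... | record { l≡ = refl ; patterns = ps } with l≐
  ...   | app qs = _ , _ , refl , ≐ˢ-value ps qs

  redex-nonvalue : ∀ {D u v} → Evaluation D → Contracts u v → ¬ Value (D ⟨ u ⟩)
  redex-nonvalue e c with contracts-functionCall c
  ... | _ , _ , refl , _ = functionCall-nonvalue e

  no-inner-redex : ∀ {u v b ts i D u′ v′} → Contracts u v → Evaluation D → Contracts u′ v′ →
    u ≢ app b (ts [ i ]≔ (D ⟨ u′ ⟩))
  no-inner-redex {i = i} c e c′ eq with contracts-functionCall c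
  no-inner-redex {ts = ts} {i} c e c′ refl | f , _ , refl , vs =
    redex-nonvalue e c′ (subst Value (lookup∘update i ts _) (All-lookup vs i))

  -- Both contexts follow the same path. If they entered different arguments, the one further right
  -- would require the other argument to be a value, yet that argument contains a redex. Neither can
  -- stop before the other, because the arguments of a redex are values.
  contracts-in-context-unique : ∀ {D D′ u v u′ v′} → Evaluation D → Evaluation D′ →
    Contracts u v → Contracts u′ v′ → D ⟨ u ⟩ ≡ D′ ⟨ u′ ⟩ → D ⟨ v ⟩ ≡ D′ ⟨ v′ ⟩
  contracts-in-context-unique ◇ ◇ c c′ refl = contracts-unique c c′
  contracts-in-context-unique ◇ (app b ts i {D} _ e) c c′ eq =
    contradiction eq (no-inner-redex {ts = ts} {i} {D} c e c′)
  contracts-in-context-unique (app b ts i {D} _ e) ◇ c c′ eq =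
    contradiction (sym eq) (no-inner-redex {ts = ts} {i} {D} c′ e c)
  contracts-in-context-unique {u = u} {v} {u′} {v′} (app b ts i {D} vs e) (app b′ ts′ i′ {D′} vs′ e′) c c′ eq
    with app-injective eq
  ... | refl , eq′ with Fin.<-cmp i i′
  ...   | tri< i<i′ i≢i′ _ = contradiction
      (subst Value (trans (sym (lookup∘update′ i≢i′ ts′ _))
        (trans (cong (λ us → lookup us i) (sym eq′)) (lookup∘update i ts _))) (vs′ i i<i′))
      (redex-nonvalue e c)
  ...   | tri> _ i≢i′ i′<i = contradiction
      (subst Value (trans (sym (lookup∘update′ (i≢i′ ∘ sym) ts _))
        (trans (cong (λ us → lookup us i′) eq′) (lookup∘update i′ ts′ _))) (vs i′ i′<i))
      (redex-nonvalue e′ c′)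
  ...   | tri≈ _ refl _ = cong (app b)
      (trans (sym ([]≔-idempotent ts i))
        (trans (cong₂ (λ us w → us [ i ]≔ w) eq′ same) ([]≔-idempotent ts′ i)))
    where
    same : D ⟨ v ⟩ ≡ D′ ⟨ v′ ⟩
    same = contracts-in-context-unique e e′ c c′
      (trans (sym (lookup∘update i ts _)) (trans (cong (λ us → lookup us i) eq′) (lookup∘update i ts′ _)))

  →ᶜ-deterministic : ∀ {s t t′} → s →ᶜ t → s →ᶜ t′ → t ≡ t′
  →ᶜ-deterministic p q = unique p q refl
    where
    unique : ∀ {s s′ t t′} → s →ᶜ t → s′ →ᶜ t′ → s ≡ s′ → t ≡ t′
    unique (step rule e l≐ r≐ _ _) (step rule′ e′ l′≐ r′≐ _ _) =
      contracts-in-context-unique e e′ (contraction rule l≐ r≐) (contraction rule′ l′≐ r′≐)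

  →ᶜ-ground : ∀ {s t} → s →ᶜ t → Ground t
  →ᶜ-ground (step {E = D} _ _ _ r≐ ground _) = context-ground D ground (≐-ground r≐)

  →ᴿ-ground : ∀ {s t} → s →ᴿ t → Ground t
  →ᴿ-ground (C p)          = →ᶜ-ground p
  →ᴿ-ground (E _ g _ _ _)  = g
  →ᴿ-ground (Q {t = t} canonical ground steps _) = ∑-ground λ
    { i x (·ˡ m) → ∑-ground⁻ ground i x (·ˡ m)
    ; i x (·ʳ m) → ground-t i (steps i) x m }
    where
    ground-t : ∀ i {s} → (NFᶜ s × t i ≡ s) ⊎ (s →ᴿ t i) → Ground (t i)
    ground-t i (inj₁ ((g , _) , t≡s)) x m = g x (subst (x ∈ᵗ_) t≡s m)
    ground-t i (inj₂ p)               x m = →ᴿ-ground p x m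

-- Termination by dependency pairs

-- Excluded middle for Σ-types yields witnesses, hence dependent choice.
no-descent⇒accessible : ExcludedMiddle 0ℓ → {A : Set} (_<_ : Rel A 0ℓ) →
  ¬ (Σ[ f ∈ (ℕ → A) ] (∀ n → f (suc n) < f n)) → ∀ x → Acc _<_ x
no-descent⇒accessible em {A} _<_ no-descent x with em {Acc _<_ x}
... | yes accessible = accessible
... | no inaccessible = contradiction (proj₁ ∘ chain , descends) no-descent
  where
  Inaccessible : Set
  Inaccessible = Σ[ y ∈ A ] ¬ Acc _<_ y

  next : (y : Inaccessible) → Σ[ z ∈ Inaccessible ] (proj₁ z < proj₁ y)
  next (y , ¬acc) with em {Σ[ z ∈ Inaccessible ] (proj₁ z < y)}
  ... | yes found = found
  ... | no none   = contradiction (acc smaller) ¬acc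
    where
    smaller : ∀ {z} → z < y → Acc _<_ z
    smaller {z} z<y with em {Acc _<_ z}
    ... | yes accessible  = accessible
    ... | no inaccessible = contradiction ((z , inaccessible) , z<y) none

  chain : ℕ → Inaccessible
  chain zero    = x , inaccessible
  chain (suc n) = proj₁ (next (chain n))

  descends : ∀ n → proj₁ (chain (suc n)) < proj₁ (chain n)
  descends n = proj₂ (next (chain n))

module Embedding (R : STRS) where

  open STRS R
  open Terms alphabet
  open DependencyPairs R

  mutual
    embed-classical : ∀ {t} → Classical t → ♯.Classical (embed t)
    embed-classical (var x)          = ♯.var x
    embed-classical (app (con c) ps) = ♯.app _ (embeds-classical ps)
    embed-classical (app (fun f) ps) = ♯.app _ (embeds-classical ps)

    embeds-classical : ∀ {n} {ts : Vec Term n} → All Classical ts → All ♯.Classical (embeds ts)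
    embeds-classical []       = []
    embeds-classical (p ∷ ps) = embed-classical p ∷ embeds-classical ps

  mutual
    embed-value : ∀ {t} → Value t → ♯.Value (embed t)
    embed-value (con c vs) = ♯.con c (embeds-value vs)
    embed-value (g · v)    = g ♯.· embed-value v
    embed-value (v + w)    = embed-value v ♯.+ embed-value w

    embeds-value : ∀ {n} {ts : Vec Term n} → All Value ts → All ♯.Value (embeds ts)
    embeds-value []       = []
    embeds-value (v ∷ vs) = embed-value v ∷ embeds-value vs

  embed-substitution : Substitution → ♯.Substitution
  embed-substitution σ = record { map = embed ∘ map σ ; values = embed-value ∘ values σ }

  mutual
    embed-≐ : ∀ {σ t u} → Classical t → t [ σ ]≐ u → embed t ♯.[ embed-substitution σ ]≐ embed u
    embed-≐ (var x)          var      = ♯.var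
    embed-≐ (app (con c) ps) (app qs) = ♯.app (embeds-≐ ps qs)
    embed-≐ (app (fun f) ps) (app qs) = ♯.app (embeds-≐ ps qs)

    embeds-≐ : ∀ {σ n} {ts us : Vec Term n} → All Classical ts → Pointwise (λ t u → t [ σ ]≐ u) ts us →
      Pointwise (λ t u → t ♯.[ embed-substitution σ ]≐ u) (embeds ts) (embeds us)
    embeds-≐ []       []       = []
    embeds-≐ (p ∷ ps) (q ∷ qs) = embed-≐ p q ∷ embeds-≐ ps qs

  embeds-update : ∀ {n} (ts : Vec Term n) i t → embeds (ts [ i ]≔ t) ≡ embeds ts [ i ]≔ embed t
  embeds-update (_ ∷ ts) zero    t = refl
  embeds-update (s ∷ ts) (suc i) t = cong (embed s ∷_) (embeds-update ts i t)

module ClassicalReduction (R : STRS) where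

  open STRS R
  open Terms alphabet
  open Substitutions alphabet

  infix 4 _⇝ʳ_ _⇝_ _⇝ᵛ_

  -- Amplitudes are forgotten: the result is the instance of one classical summand of the right-hand
  -- side. All images under `σ` are classical, as closure of the order under substitution demands.
  data _⇝ʳ_ : Rel Term 0ℓ where
    contract : ∀ {l r c σ l′ c′} → ℛ l r → c ◁ r → (∀ x → Classical (map σ x)) →
      l [ σ ]≐ l′ → c [ σ ]≐ c′ → l′ ⇝ʳ c′

  -- Arguments may be reduced in any order, also where no evaluation context reaches. The larger
  -- relation still terminates, and it treats all arguments alike.
  data _⇝_ : Rel Term 0ℓ where
    root : ∀ {s t} → s ⇝ʳ t → s ⇝ t
    arg  : ∀ b ts i {t} → lookup ts i ⇝ t → app b ts ⇝ app b (ts [ i ]≔ t)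

  _⇝ᵛ_ : ∀ {n} → Rel (Vec Term n) 0ℓ
  ts ⇝ᵛ us = ∃[ i ] ∃[ t ] (lookup ts i ⇝ t × us ≡ ts [ i ]≔ t)

  SN : Term → Set
  SN = Acc (flip _⇝_)

  SNᵛ : ∀ {n} → Vec Term n → Set
  SNᵛ = Acc (flip _⇝ᵛ_)

  -- Steps in the head and in the tail are independent: each shrinks one accessibility proof and
  -- keeps the other.
  SNᵛ-∷ : ∀ {n t} {ts : Vec Term n} → SN t → SNᵛ ts → SNᵛ (t ∷ ts)
  SNᵛ-∷ sn@(acc rs) sns@(acc rss) = acc λ
    { (zero  , _ , step , refl) → SNᵛ-∷ (rs step) sns
    ; (suc i , _ , step , refl) → SNᵛ-∷ sn (rss (i , _ , step , refl)) }

  All-SN⇒SNᵛ : ∀ {n} {ts : Vec Term n} → All SN ts → SNᵛ ts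
  All-SN⇒SNᵛ []         = acc λ { (() , _) }
  All-SN⇒SNᵛ (sn ∷ sns) = SNᵛ-∷ sn (All-SN⇒SNᵛ sns)

  -- The predicate `I` carries whatever a root step has to know about the arguments after some of
  -- them have been reduced.
  SN-app : ∀ b (I : Vec Term (arity b) → Set) →
    (∀ {ts i t} → I ts → lookup ts i ⇝ t → I (ts [ i ]≔ t)) →
    (∀ {ts t} → I ts → app b ts ⇝ʳ t → SN t) →
    ∀ {ts} → SNᵛ ts → I ts → SN (app b ts)
  SN-app b I preserved roots (acc rs) inv = acc λ
    { (root step)       → roots inv step
    ; (arg _ ts i step) → SN-app b I preserved roots (rs (i , _ , step , refl)) (preserved inv step) }

  con-⇝ʳ-irreducible : ∀ {c ts t} → ¬ (app (con c) ts ⇝ʳ t)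
  con-⇝ʳ-irreducible (contract rule _ _ l≐ _) with rules rule
  ... | record { l≡ = refl } with l≐
  ...   | ()

  var-⇝ʳ-irreducible : ∀ {x t} → ¬ (var x ⇝ʳ t)
  var-⇝ʳ-irreducible (contract rule _ _ l≐ _) with rules rule
  ... | record { l≡ = refl } with l≐
  ...   | ()

  SN-con : ∀ c {ts} → All SN ts → SN (app (con c) ts)
  SN-con c sns = SN-app (con c) (λ _ → ⊤) _
    (λ _ step → contradiction step con-⇝ʳ-irreducible) (All-SN⇒SNᵛ sns) tt

  mutual
    SN-value : ∀ {v} → Classical v → Value v → SN v
    SN-value (app _ ps) (con c vs) = SN-con c (SN-values ps vs)

    SN-values : ∀ {n} {vs : Vec Term n} → All Classical vs → All Value vs → All SN vs
    SN-values []       []       = []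
    SN-values (p ∷ ps) (v ∷ vs) = SN-value p v ∷ SN-values ps vs

  ◁-classical : ∀ {c r} → c ◁ r → Classical c
  ◁-classical (_ , _ , _ , _ , canonical , i , refl) = Canonical.classical canonical i

  argument-context : ∀ C b ts i → ∃[ D ] D ⟨ lookup ts i ⟩ ≡ C ⟨ app b ts ⟩
  argument-context ◇ b ts i = app b ts i ◇ , cong (app b) ([]≔-lookup ts i)
  argument-context (app b′ us j C) b ts i =
    let D , eq = argument-context C b ts i in app b′ us j D , cong (λ s → app b′ (us [ j ]≔ s)) eq
  argument-context (α · C) b ts i =
    let D , eq = argument-context C b ts i in α · D , cong (α ·_) eq
  argument-context (+ˡ C u) b ts i =
    let D , eq = argument-context C b ts i in +ˡ D u , cong (_+ u) eq
  argument-context (+ʳ u C) b ts i =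
    let D , eq = argument-context C b ts i in +ʳ u D , cong (u +_) eq

module _ (em : ExcludedMiddle 0ℓ) (R : STRS) where

  open STRS R
  open Terms alphabet
  open DependencyPairs R
  open Orders (alphabet ♯)
  open Substitutions alphabet
  open Embedding R
  open ClassicalReduction R

  module DependencyPairTermination
    (_⪰_ : Rel ♯.Term 0ℓ)
    (quasiOrder   : IsQuasiOrder _⪰_)
    (wellFounded  : WellFounded _⪰_)
    (monotonic    : WeaklyMonotonic _⪰_)
    (⪰-closed     : ClosedUnderSubstitution _⪰_)
    (≻-closed     : ClosedUnderSubstitution (Strict _⪰_))
    (rule-⪰       : ∀ {l r p} → ℛ l r → p ◁ r → embed l ⪰ embed p)
    (dependency-≻ : ∀ {s t} → DependencyPair s t → Strict _⪰_ s t)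
    where

    open IsQuasiOrder quasiOrder

    -- Classicality is built in because the hypotheses constrain the order on classical terms only.
    _≺_ : Rel ♯.Term 0ℓ
    t ≺ s = ♯.Classical s × ♯.Classical t × Strict _⪰_ s t

    ≺-accessible : ∀ s → Acc _≺_ s
    ≺-accessible = no-descent⇒accessible em _≺_ λ (f , descends) →
      wellFounded (f , (λ n → proj₁ (descends n)) , λ n → proj₂ (proj₂ (descends n)))

    embed-monotonic : ∀ b {ts} i {s t} → All Classical ts → Classical s → Classical t →
      embed s ⪰ embed t → embed (app b (ts [ i ]≔ s)) ⪰ embed (app b (ts [ i ]≔ t))
    embed-monotonic (con c) {ts} i ps p q s⪰t =
      subst₂ (λ us vs → ♯.app (♯.con c) us ⪰ ♯.app (♯.con c) vs)
        (sym (embeds-update ts i _)) (sym (embeds-update ts i _))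
        (monotonic (♯.con c) i (embeds-classical ps) (embed-classical p) (embed-classical q) s⪰t)
    embed-monotonic (fun f) {ts} i ps p q s⪰t =
      subst₂ (λ us vs → ♯.app (♯.fun (inj₁ f)) us ⪰ ♯.app (♯.fun (inj₁ f)) vs)
        (sym (embeds-update ts i _)) (sym (embeds-update ts i _))
        (monotonic (♯.fun (inj₁ f)) i (embeds-classical ps) (embed-classical p) (embed-classical q) s⪰t)

    tuple-monotonic : ∀ f {ts} i {s t} → All Classical ts → Classical s → Classical t →
      embed s ⪰ embed t → tuple f (ts [ i ]≔ s) ⪰ tuple f (ts [ i ]≔ t)
    tuple-monotonic f {ts} i ps p q s⪰t =
      subst₂ (λ us vs → ♯.app (♯.fun (inj₂ f)) us ⪰ ♯.app (♯.fun (inj₂ f)) vs)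
        (sym (embeds-update ts i _)) (sym (embeds-update ts i _))
        (monotonic (♯.fun (inj₂ f)) i (embeds-classical ps) (embed-classical p) (embed-classical q) s⪰t)

    -- Rules decrease weakly, and weak monotonicity lifts this through the surrounding symbols. It
    -- ensures that reducing the arguments of a call never raises its tuple term.
    ⇝-⪰ : ∀ {s t} → Classical s → s ⇝ t → Classical t × embed s ⪰ embed t
    ⇝-⪰ _ (root (contract {σ = σ} rule c◁r σ-classical l≐ c≐)) with rules rule
    ... | record { l≡ = refl ; patterns = ps } =
      ≐-classical σ-classical c-classical c≐ ,
      ⪰-closed (embed-substitution σ) (embed-classical ∘ σ-classical)
        (embed-classical l-classical) (embed-classical c-classical) (rule-⪰ rule c◁r)
        (embed-≐ l-classical l≐) (embed-≐ c-classical c≐)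
      where
      l-classical = app _ (patterns⇒classical ps)
      c-classical = ◁-classical c◁r
    ⇝-⪰ (app _ ps) (arg b ts i {t} step) =
      let p = All-lookup ps i
          q , s⪰t = ⇝-⪰ p step
      in app b (All-update i ps q) ,
         subst (λ us → embed (app b us) ⪰ embed (app b (ts [ i ]≔ t))) ([]≔-lookup ts i)
           (embed-monotonic b i ps p q s⪰t)

    tuple-classical : ∀ f {ts} → All Classical ts → ♯.Classical (tuple f ts)
    tuple-classical f ps = ♯.app _ (embeds-classical ps)

    -- Outer induction on the tuple term in ≺, inner induction on the reductions of the arguments.
    SN-fun : ∀ {u} → ♯.Classical u → Acc _≺_ u → ∀ f {ts} →
      All Classical ts → All SN ts → u ⪰ tuple f ts → SN (app (fun f) ts)
    SN-fun {u} u-classical (acc rs) f ps sns u⪰ =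
      SN-app (fun f) Invariant preserved roots (All-SN⇒SNᵛ sns) (ps , sns , u⪰)
      where
      -- The bound `u` stays fixed while the arguments are reduced. Such steps decrease the tuple
      -- term only weakly, so they could not consume the accessibility proof of `u`.
      Invariant : Vec Term (ar ℱ f) → Set
      Invariant ts = All Classical ts × All SN ts × u ⪰ tuple f ts

      preserved : ∀ {ts i t} → Invariant ts → lookup ts i ⇝ t → Invariant (ts [ i ]≔ t)
      preserved {ts} {i} {t} (ps , sns , u⪰) step =
        let p = All-lookup ps i
            q , s⪰t = ⇝-⪰ p step
            qs = All-update i ps q
        in qs , All-update i sns (acc-inverse (All-lookup sns i) step) ,
           transitive u-classical (tuple-classical f ps) (tuple-classical f qs) u⪰
             (subst (λ us → tuple f us ⪰ tuple f (ts [ i ]≔ t)) ([]≔-lookup ts i)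
               (tuple-monotonic f i ps p q s⪰t))

      roots : ∀ {ts t} → Invariant ts → app (fun f) ts ⇝ʳ t → SN t
      roots {ts} (ps , _ , u⪰) (contract {c = c} {σ} rule c◁r σ-classical l≐ c≐) with rules rule
      ... | record { args = args ; l≡ = refl ; patterns = pats } with l≐
      ...   | app args≐ = subterm (◇ , refl) (◁-classical c◁r) c≐
        where
        args-classical = patterns⇒classical pats

        mutual
          -- Recursion over the subterms `d` of `c`. The context witnessing that `d` lies in `c`
          -- turns each function call met on the way into a dependency pair; at a variable the
          -- instance is a classical value, which terminates anyway.
          subterm : ∀ {d w} → ∃[ D ] D ⟨ d ⟩ ≡ c → Classical d → d [ σ ]≐ w → SN w
          subterm _ (var x) var = SN-value (σ-classical x) (values σ x)
          subterm inside (app (con k) ds) (app ds≐) = SN-con k (subterms (argument inside) ds ds≐)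
          subterm {app _ ds} {app _ ws} inside@(D , D⟨d⟩≡c) (app (fun g) ds-classical) (app ds≐) =
            SN-fun (tuple-classical g ws-classical)
              (rs (u-classical , tuple-classical g ws-classical , u≻))
              g ws-classical (subterms (argument inside) ds-classical ds≐)
              (reflexive (tuple-classical g ws-classical))
            where
            ws-classical = ≐ˢ-classical σ-classical ds-classical ds≐

            tuples-≻ : Strict _⪰_ (tuple f ts) (tuple g ws)
            tuples-≻ = ≻-closed (embed-substitution σ) (embed-classical ∘ σ-classical)
              (tuple-classical f args-classical) (tuple-classical g ds-classical)
              (dependency-≻ (⟨_,_⟩ {C = D} rule (subst (_◁ _) (sym D⟨d⟩≡c) c◁r)))
              (♯.app (embeds-≐ args-classical args≐)) (♯.app (embeds-≐ ds-classical ds≐))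

            u≻ : Strict _⪰_ u (tuple g ws)
            u≻ =
              transitive u-classical (tuple-classical f ps) (tuple-classical g ws-classical) u⪰ (proj₁ tuples-≻) ,
              λ ⪰u → proj₂ tuples-≻
                (transitive (tuple-classical g ws-classical) u-classical (tuple-classical f ps) ⪰u u⪰)

          argument : ∀ {b ds} → ∃[ D ] D ⟨ app b ds ⟩ ≡ c → ∀ i → ∃[ D ] D ⟨ lookup ds i ⟩ ≡ c
          argument (D , eq) i = let D′ , eq′ = argument-context D _ _ i in D′ , trans eq′ eq

          subterms : ∀ {n} {ds ws : Vec Term n} → (∀ i → ∃[ D ] D ⟨ lookup ds i ⟩ ≡ c) →
            All Classical ds → Pointwise (λ d w → d [ σ ]≐ w) ds ws → All SN ws
          subterms inside []       []       = []
          subterms inside (p ∷ ps) (q ∷ qs) = subterm (inside zero) p q ∷ subterms (inside ∘ suc) ps qs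

    mutual
      SN-classical : ∀ {t} → Classical t → SN t
      SN-classical (var x) = acc λ { (root step) → contradiction step var-⇝ʳ-irreducible }
      SN-classical (app (con c) ps) = SN-con c (SN-classicals ps)
      SN-classical (app (fun f) ps) =
        SN-fun (tuple-classical f ps) (≺-accessible _) f ps (SN-classicals ps) (reflexive (tuple-classical f ps))

      SN-classicals : ∀ {n} {ts : Vec Term n} → All Classical ts → All SN ts
      SN-classicals []       = []
      SN-classicals (p ∷ ps) = SN-classical p ∷ SN-classicals ps

-- Supports and heights

module Supports (em : ExcludedMiddle 0ℓ) (R : STRS) (unitDenotable : Terms.UnitDenotable (STRS.alphabet R))
  (M : AmplitudeModel (STRS.alphabet R)) where

  open STRS R
  open Reduction R
  open Substitutions alphabet
  open Determinism R
  open ClassicalReduction R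
  open CanonicalForms em alphabet unitDenotable
  open Coefficients em M

  -- The choice of assignment is immaterial: reduction acts on ground terms, whose amplitudes have
  -- the same value under all assignments.
  origin : 𝒳 → ℕ
  origin _ = 0

  Support : Term → Term → Set
  Support t q = ¬ (coef origin var t q ≃ 𝟘)

  support-≋ : ∀ {s t q} → s ≋ t → Support s q → Support t q
  support-≋ s≋t nonzero t≈0 = nonzero (K.trans (coef-≋ s≋t _) t≈0)

  support-classical : ∀ {t q} → Classical t → Support t q → t ≡ q
  support-classical p nonzero = trans (sym (instantiate-var p)) (coef-classical p nonzero)

  coef-self : ∀ {t} → Classical t → coef origin var t t ≃ 𝟙
  coef-self {t} p = subst (λ q → coef origin var t q ≃ 𝟙) (instantiate-var p) (coef-instance p)

  support-self : ∀ {t} → Classical t → Support t t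
  support-self p t≈0 = 𝟙≄𝟘 (K.trans (K.sym (coef-self p)) t≈0)

  -- Since the `t i` are distinct and classical, the coefficient of `t i` is exactly the value of
  -- `α i`; groundness is what makes this value nonzero.
  support-∑ : ∀ {n} {α : Fin (suc n) → Amp} {t} → Canonical α t → Ground (∑ α t) → ∀ i → Support (∑ α t) (t i)
  support-∑ {α = α} {t} canonical ground i ∑≈0 =
    value-nonzero (λ x m → ∑-ground⁻ ground i x (·ˡ m)) (nonzero i)
      (K.trans (K.sym (K.*-identityʳ _)) (K.trans (K.*-congˡ (K.sym (coef-self (classical i)))) (K.trans (K.sym coef-i) ∑≈0)))
    where
    open Canonical canonical
    coef-i : coef origin var (∑ α t) (t i) ≃ value origin (α i) ⊠ coef origin var (t i) (t i)
    coef-i = coef-∑-single i λ j j≢i → coef-noninstance (classical j)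
      λ eq → j≢i (distinct (trans (sym (instantiate-var (classical j))) eq))

  -- The canonical form is taken before instantiation. Different summands may acquire the same
  -- instance, and amplitudes may vanish at `ρ`, but a nonzero coefficient must come from some
  -- summand.
  ∈-canonical : ∀ {ρ η r q} → ¬ (coef ρ η r q ≃ 𝟘) → ∃[ c ] (c ◁ r × instantiate η c ≡ q)
  ∈-canonical {r = r} nonzero with canonicalForm r
  ... | inj₁ (α , s , α≈0 , r≋) = contradiction
    (K.trans (coef-≋ r≋ _) (K.trans (K.*-congʳ (value-zero α≈0)) (K.zeroˡ _))) nonzero
  ... | inj₂ (n , α , t , r≋ , canonical) =
    let i , t-nonzero = coef-∑-nonzero {α = α} {t} λ ∑≈0 → nonzero (K.trans (coef-≋ r≋ _) ∑≈0)
    in t i , (n , α , t , r≋ , canonical , i , refl) ,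
       coef-classical (Canonical.classical canonical i) t-nonzero

  -- A classical instance of `l` forces classical images only for the variables of `l`. All others
  -- are sent to the unit constructor, so that the order's closure under classical substitutions
  -- becomes applicable.
  classical-substitution : ∀ {l σ l′} → l [ σ ]≐ l′ → Classical l′ →
    ∃[ τ ] ((∀ x → Classical (map τ x)) × (∀ x → x ∈ᵗ l → map σ x ≡ map τ x))
  classical-substitution {l} {σ} l≐ p = record { map = proj₁ ∘ image ; values = proj₁ ∘ proj₂ ∘ image } ,
    proj₁ ∘ proj₂ ∘ proj₂ ∘ image , λ x → proj₂ (proj₂ (proj₂ (image x)))
    where
    image : ∀ x → ∃[ v ] (Value v × Classical v × (x ∈ᵗ l → map σ x ≡ v))
    image x with em {x ∈ᵗ l}
    ... | yes x∈l = map σ x , values σ x , ≐-classical⁻ l≐ p x∈l , λ _ → refl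
    ... | no x∉l  = app (con unit) [] , con unit [] , app (con unit) [] , λ x∈l → contradiction x∈l x∉l

  -- The link from superposed to classical reduction. The coefficient of `q` in the instance of `r`
  -- equals its coefficient in `r` under the reading given by `τ`, and there the canonical form of
  -- `r` supplies a summand whose instance is `q`.
  support-contraction : ∀ {u v q} → Contracts u v → Classical u → Support v q → u ⇝ʳ q
  support-contraction (contraction {l} {r} rule l≐ r≐) p nonzero =
    let τ , τ-classical , agree = classical-substitution l≐ p
        ρ , values-agree = value-subst τ origin
        r≐′ = ≐-agree (λ x x∈r → agree x (IsRule.variables (rules rule) x x∈r)) r≐
        c , c◁r , eq = ∈-canonical λ r≈0 →
          nonzero (K.trans (coef-subst τ-classical values-agree r≐′ _) r≈0)
    in contract rule c◁r τ-classical (≐-agree agree l≐)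
         (subst (c [ τ ]≐_) eq (instantiate-≐ τ (◁-classical c◁r)))

  -- A nonzero product has no zero factor. At each untouched argument, which is classical, this
  -- forces equality; at position `i` it leaves a term of the support of `t`.
  coefs-update : ∀ {n} (ts : Vec Term n) i {s t qs} → All Classical (ts [ i ]≔ s) →
    ¬ (coefs origin var (ts [ i ]≔ t) qs ≃ 𝟘) → ∃[ q ] (qs ≡ ts [ i ]≔ q × Support t q)
  coefs-update (_ ∷ ts) zero {qs = q ∷ qs} (_ ∷ ps) nonzero =
    q ,
    cong (q ∷_) (sym (trans (sym (instantiates-var ps)) (coefs-classical ps
      λ ≈0 → nonzero (K.trans (K.*-congˡ ≈0) (K.zeroʳ _))))) ,
    λ ≈0 → nonzero (K.trans (K.*-congʳ ≈0) (K.zeroˡ _))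
  coefs-update (_ ∷ ts) (suc i) {qs = _ ∷ _} (p ∷ ps) nonzero =
    let q , eq , q-nonzero = coefs-update ts i ps λ ≈0 → nonzero (K.trans (K.*-congˡ ≈0) (K.zeroʳ _))
    in q , cong₂ _∷_ (sym (support-classical p λ ≈0 → nonzero (K.trans (K.*-congʳ ≈0) (K.zeroˡ _)))) eq ,
       q-nonzero

  support-context : ∀ {D u v q} → Evaluation D → Contracts u v → Classical (D ⟨ u ⟩) →
    Support (D ⟨ v ⟩) q → D ⟨ u ⟩ ⇝ q
  support-context ◇ c p nonzero = root (support-contraction c p nonzero)
  support-context {u = u} {q = q} (app b ts i {D} _ e) c (app _ ps) nonzero with coef-app-cases b q
  ... | inj₁ vanishes = contradiction (K.reflexive (vanishes _)) nonzero
  ... | inj₂ (qs , refl , is) with coefs-update ts i ps (λ ≈0 → nonzero (K.trans (K.reflexive (is _)) ≈0))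
  ...   | q′ , refl , q′-nonzero = subst (λ us → app b (ts [ i ]≔ (D ⟨ u ⟩)) ⇝ app b us) ([]≔-idempotent ts i)
      (arg b (ts [ i ]≔ (D ⟨ u ⟩)) i
        (subst (_⇝ q′) (sym (lookup∘update i ts _)) (support-context e c
          (subst Classical (lookup∘update i ts _) (All-lookup ps i)) q′-nonzero)))

  →ᶜ-support : ∀ {s t q} → s →ᶜ t → Support t q → s ⇝ q
  →ᶜ-support (step rule e l≐ r≐ _ p) = support-context e (contraction rule l≐ r≐) p

  →ᶜ-classical : ∀ {s t} → s →ᶜ t → Classical s
  →ᶜ-classical (step _ _ _ _ _ p) = p

  Reducible : Term → Set
  Reducible s = ∃[ t ] s →ᶜ t

  -- A term may stay only if it is irreducible. This is what makes the maximal height drop in every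
  -- step, even when several terms attain it.
  data Follows (s q : Term) : Set where
    stays : ¬ Reducible s → s ≡ q → Follows s q
    moves : ∀ {t} → s →ᶜ t → Support t q → Follows s q

  →ᴿ-reducible : ∀ {s t} → s →ᴿ t → ∃[ p ] (Support s p × Reducible p)
  →ᴿ-reducible (C red) = _ , support-self (→ᶜ-classical red) , _ , red
  →ᴿ-reducible (E _ _ s≋s′ red _) =
    let p , p∈ , reducible = →ᴿ-reducible red in p , support-≋ (≋-sym s≋s′) p∈ , reducible
  →ᴿ-reducible (Q canonical ground _ (i , red)) =
    let p , p∈ , reducible = →ᴿ-reducible red
    in _ , support-∑ canonical ground i ,
       subst Reducible (sym (support-classical (Canonical.classical canonical i) p∈)) reducible

  -- (E) does not change supports. In (Q), `q` lies in the support of some `t i`, and the induction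
  -- hypothesis for `s i` speaks of `s i` itself, the only term in the support of a classical term.
  →ᴿ-follows : ∀ {s t q} → s →ᴿ t → Support t q → ∃[ p ] (Support s p × Follows p q)
  →ᴿ-follows (C red) q∈ = _ , support-self (→ᶜ-classical red) , moves red q∈
  →ᴿ-follows (E _ _ s≋s′ red t′≋t) q∈ =
    let p , p∈ , follows = →ᴿ-follows red (support-≋ (≋-sym t′≋t) q∈)
    in p , support-≋ (≋-sym s≋s′) p∈ , follows
  →ᴿ-follows {q = q} (Q {α = α} {s} {t} canonical ground steps _) q∈
    with coef-∑-nonzero {α = α} {t} q∈
  ... | i , q∈ᵢ = s i , support-∑ canonical ground i , follows (steps i)
    where
    sᵢ-classical = Canonical.classical canonical i
    follows : (NFᶜ (s i) × t i ≡ s i) ⊎ (s i →ᴿ t i) → Follows (s i) q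
    follows (inj₁ ((_ , normal) , t≡s)) =
      stays normal (support-classical sᵢ-classical (subst (λ u → Support u q) t≡s q∈ᵢ))
    follows (inj₂ red) =
      let p , p∈ , p-follows = →ᴿ-follows red q∈ᵢ
      in subst (λ p → Follows p q) (sym (support-classical sᵢ-classical p∈)) p-follows

  -- Counts only those steps of `⇝` that come from an actual step `→ᶜ` followed by the choice of a
  -- term in the support of the reduct.
  Height≤ : ℕ → Term → Set
  Height≤ zero    p = ¬ Reducible p
  Height≤ (suc k) p = ∀ {t} → p →ᶜ t → ∀ {q} → Support t q → Height≤ k q

  Height≤-irreducible : ∀ k {p} → ¬ Reducible p → Height≤ k p
  Height≤-irreducible zero    irreducible = irreducible
  Height≤-irreducible (suc k) irreducible red = contradiction (_ , red) irreducible

  Height≤-mono : ∀ {k m p} → k ℕ.≤ m → Height≤ k p → Height≤ m p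
  Height≤-mono {m = m} ℕ.z≤n irreducible = Height≤-irreducible m irreducible
  Height≤-mono (ℕ.s≤s k≤m) height red q∈ = Height≤-mono k≤m (height red q∈)

  bounded : ∀ {n} (P : Fin n → ℕ → Set) → (∀ {i k m} → k ℕ.≤ m → P i k → P i m) →
    (∀ i → ∃[ k ] P i k) → ∃[ k ] (∀ i → P i k)
  bounded {zero}  P mono bound = 0 , λ ()
  bounded {suc n} P mono bound =
    let k , p  = bound zero
        m , ps = bounded (P ∘ suc) mono (bound ∘ suc)
    in k ℕ.⊔ m , λ { zero → mono (ℕ.m≤m⊔n k m) p ; (suc i) → mono (ℕ.m≤n⊔m k m) (ps i) }

  support-finite : ∀ s → Σ[ n ∈ ℕ ] Σ[ t ∈ (Fin n → Term) ] (∀ {q} → Support s q → ∃[ i ] t i ≡ q)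
  support-finite s with canonicalForm s
  ... | inj₁ (α , u , α≈0 , s≋) = 0 , (λ ()) , λ q∈ → contradiction
    (K.trans (K.*-congʳ (value-zero α≈0)) (K.zeroˡ _)) (support-≋ s≋ q∈)
  ... | inj₂ (n , α , t , s≋ , canonical) = suc n , t , λ q∈ →
    let i , q∈ᵢ = coef-∑-nonzero {α = α} {t} (support-≋ s≋ q∈)
    in i , support-classical (Canonical.classical canonical i) q∈ᵢ

  support-bounded : ∀ s → (∀ {q} → Support s q → ∃[ k ] Height≤ k q) →
    ∃[ k ] (∀ {q} → Support s q → Height≤ k q)
  support-bounded s heights =
    let n , t , covers = support-finite s
        -- The covering family may contain terms outside the support, about which nothing is known;
        -- hence the bound is conditional on membership.
        k , bound = bounded (λ i k → Support s (t i) → Height≤ k (t i))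
          (λ k≤m height q∈ → Height≤-mono k≤m (height q∈)) (height ∘ t)
    in k , λ q∈ → let i , eq = covers q∈ in
      subst (λ q → Support s q → Height≤ k q) eq (bound i) q∈
    where
    height : ∀ q → ∃[ k ] (Support s q → Height≤ k q)
    height q with em {Support s q}
    ... | yes q∈ = let k , h = heights q∈ in k , λ _ → h
    ... | no q∉  = 0 , λ q∈ → contradiction q∈ q∉

  -- Only here is orthogonality needed: it makes the reduct t unique, so that the height is finite.
  SN⇒height : ∀ {p} → SN p → ∃[ k ] Height≤ k p
  SN⇒height {p} (acc rs) with em {Reducible p}
  ... | no irreducible   = 0 , irreducible
  ... | yes (t , p→t) =
    let k , bound = support-bounded t λ q∈ → SN⇒height (rs (→ᶜ-support p→t q∈))
    in suc k , λ p→t′ {q} q∈ → bound (subst (λ u → Support u q) (→ᶜ-deterministic p→t′ p→t) q∈)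

  -- Height zero on the whole support excludes any step, since a step needs a reducible term there.
  -- Otherwise each term supporting the reduct is either irreducible or one level below a term
  -- supporting `s`.
  reachesNF : ∀ k {s} → Ground s → (∀ {p} → Support s p → Height≤ k p) → ReachesNFWithin k s
  reachesNF zero ground heights = ground , λ (_ , red) →
    let p , p∈ , reducible = →ᴿ-reducible red in heights p∈ reducible
  reachesNF (suc k) {s} ground heights t red = reachesNF k (→ᴿ-ground red) λ q∈ → height (→ᴿ-follows red q∈)
    where
    height : ∀ {q} → ∃[ p ] (Support s p × Follows p q) → Height≤ k q
    height (p , p∈ , stays irreducible refl) = Height≤-irreducible k irreducible
    height (p , p∈ , moves p→t q∈)           = heights p∈ p→t q∈

  SN⇒terminating : (∀ {t} → Classical t → SN t) → Terminating
  SN⇒terminating SN-classical s ground =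
    let k , heights = support-bounded s λ {q} _ → height q in k , reachesNF k ground heights
    where
    height : ∀ q → ∃[ k ] Height≤ k q
    -- A reducible term is classical by the definition of `→ᶜ`, and an irreducible one has height 0
    -- whether or not it is classical.
    height q with em {Reducible q}
    ... | yes (_ , red) = SN⇒height (SN-classical (→ᶜ-classical red))
    ... | no irreducible = 0 , irreducible

theorem37 : ExcludedMiddle 0ℓ → (R : STRS) →
    let open STRS R
        open Reduction R
        open DependencyPairs R
        open Orders (alphabet ♯)
    in
    UnitDenotable →
    (Σ[ _⪰_ ∈ Rel ♯.Term 0ℓ ]
      ( IsQuasiOrder _⪰_
      × WellFounded _⪰_
      × WeaklyMonotonic _⪰_
      × ClosedUnderSubstitution _⪰_
      × ClosedUnderSubstitution (Strict _⪰_)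
      × (∀ {l r p} → ℛ l r → p ◁ r → embed l ⪰ embed p)
      × (∀ {s t} → DependencyPair s t → Strict _⪰_ s t))) →
    Terminating
theorem37 em R unitDenotable (_⪰_ , quasiOrder , wellFounded , monotonic , ⪰-closed , ≻-closed , rule-⪰ , dependency-≻) =
  SN⇒terminating SN-classical
  where
  open Supports em R unitDenotable (ℂ-model em (STRS.alphabet R))
  open DependencyPairTermination em R _⪰_ quasiOrder wellFounded monotonic ⪰-closed ≻-closed rule-⪰ dependency-≻
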